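{- For all integers $n\geq 0$, the Fibonacci-Fubini number $\mathcal{F}_n$ satisfies the Dobiński-like formula $$\mathcal{F}_n=\frac{1}{\sqrt{5}}\left(\frac{\alpha}{e^{\alpha}}\sum_{k\geq 0} \frac{\alpha^k k^n}{k!}-\frac{\beta}{e^{\beta}}\sum_{k\geq 0} \frac{\beta^k k^n}{k!}\right).$$
   Context: $\alpha=(1+\sqrt5)/2$ and $\beta=(1-\sqrt5)/2$. Convention: $0^0=1$. A permutation $\sigma=\sigma_1\cdots\sigma_k$ of $\{1,\dots,k\}$ is a Fibonacci permutation if $|\sigma_i-i|\le 1$ for every $i$. For a set partition of $[n]=\{1,\dots,n\}$ into non-empty blocks $B_1|B_2|\cdots|B_k$, the blocks are always listed so that $\min B_1<\min B_2<\cdots<\min B_k$. A Fibonacci ordered partition of $[n]$ is an arrangement $B_{\sigma_1}|B_{\sigma_2}|\cdots|B_{\sigma_k}$ where $B_1|\cdots|B_k$ is a partition of $[n]$ (any number $k$ of blocks) and $\sigma$ is a Fibonacci permutation of $\{1,\dots,k\}$. The Fibonacci-Fubini number $\mathcal{F}_n$ is the total number of Fibonacci ordered partitions of $[n]$ (for $n=0$ the empty partition with $k=0$ blocks is counted once, so $\mathcal{F}_0=1$). -}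

module Defs where

open import Algebra.Bundles.Raw using (RawSemiring)
import Algebra.Definitions.RawSemiring as RawSemiringDefinitions
open import Data.Fin.Base as Fin using (Fin; toℕ)
open import Data.Fin.Permutation using (Permutation′; _⟨$⟩ʳ_)
open import Data.Fin.Subset using (Subset; _∈_; _∩_; Empty; Nonempty)
open import Data.Integer.Base as ℤ using (+_; -[1+_])
import Data.Integer.Properties as ℤP
open import Data.Nat.Base as ℕ using (ℕ; zero; suc; _!)
open import Data.Nat.Properties as ℕP using (_!≢0)
open import Data.Product.Base using (Σ; ∃; _×_; _,_; proj₁; proj₂)
open import Data.Rational.Base as ℚ using (ℚ; mkℚ; 0ℚ; 1ℚ; ½; ∣_∣)
import Data.Rational.Properties as ℚP
import Data.Rational.Unnormalised.Base as ℚᵘ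
import Data.Rational.Unnormalised.Properties as ℚᵘP
open import Data.Rational.Solver using (module +-*-Solver)
open import Data.Refinement using (Refinement)
open import Data.Sum.Base using (inj₁; inj₂)
open import Data.Vec.Base using (Vec; lookup; tabulate)
open import Function.Base using (_∘_)
open import Function.Bundles using (_↔_)
open import Level using (0ℓ)
open import Relation.Binary.PropositionalEquality
open import Relation.Nullary using (yes; no; contradiction)

module Rational where

  open import Data.Rational.Base
    using (_+_; _*_; _-_; -_; _≤_; _<_; 1/_; NonNegative; positive; nonNegative)
  open ℚP.≤-Reasoning
  open +-*-Solver

  2ℚ 3ℚ 5ℚ 7ℚ : ℚ
  2ℚ = + 2 ℚ./ 1
  3ℚ = + 3 ℚ./ 1
  5ℚ = + 5 ℚ./ 1
  7ℚ = + 7 ℚ./ 1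

  0<1 : 0ℚ < 1ℚ
  0<1 = ℚP.positive⁻¹ 1ℚ

  0<* : ∀ {p q} → 0ℚ < p → 0ℚ < q → 0ℚ < p * q
  0<* {p} {q} 0<p 0<q = ℚP.positive⁻¹ (p * q)
    where instance
      _ = positive 0<p
      _ = positive 0<q
      _ = ℚP.pos*pos⇒pos p q

  0<½* : ∀ {p} → 0ℚ < p → 0ℚ < ½ * p
  0<½* = 0<* (ℚP.positive⁻¹ ½)

  0<1+∣_∣ : ∀ p → 0ℚ < ∣ p ∣ + 1ℚ
  0<1+∣ p ∣ = begin-strict
    0ℚ          ≡⟨ refl ⟩
    0ℚ + 0ℚ     <⟨ ℚP.+-mono-≤-< (ℚP.0≤∣p∣ p) 0<1 ⟩
    ∣ p ∣ + 1ℚ  ∎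

  0≤q-p : ∀ {p q} → p ≤ q → 0ℚ ≤ q - p
  0≤q-p {p} {q} p≤q = begin
    0ℚ      ≡⟨ ℚP.+-inverseʳ p ⟨
    p - p   ≤⟨ ℚP.+-monoˡ-≤ (- p) p≤q ⟩
    q - p   ∎

  *-mono-≤ : ∀ {p q r s} → 0ℚ ≤ r → 0ℚ ≤ q → p ≤ q → r ≤ s → p * r ≤ q * s
  *-mono-≤ {p} {q} {r} {s} 0≤r 0≤q p≤q r≤s = begin
    p * r  ≤⟨ ℚP.*-monoʳ-≤-nonNeg r {{nonNegative 0≤r}} p≤q ⟩
    q * r  ≤⟨ ℚP.*-monoˡ-≤-nonNeg q {{nonNegative 0≤q}} r≤s ⟩
    q * s  ∎

  ∣p*q∣≤ : ∀ p q {a b} → ∣ p ∣ ≤ a → ∣ q ∣ ≤ b → ∣ p * q ∣ ≤ a * b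
  ∣p*q∣≤ p q {a} {b} p≤a q≤b = begin
    ∣ p * q ∣      ≡⟨ ℚP.∣p*q∣≡∣p∣*∣q∣ p q ⟩
    ∣ p ∣ * ∣ q ∣  ≤⟨ *-mono-≤ (ℚP.0≤∣p∣ q) (ℚP.≤-trans (ℚP.0≤∣p∣ p) p≤a) p≤a q≤b ⟩
    a * b          ∎

  ∣p+q∣≤ : ∀ p q {a b} → ∣ p ∣ ≤ a → ∣ q ∣ ≤ b → ∣ p + q ∣ ≤ a + b
  ∣p+q∣≤ p q p≤a q≤b = ℚP.≤-trans (ℚP.∣p+q∣≤∣p∣+∣q∣ p q) (ℚP.+-mono-≤ p≤a q≤b)

  ½p+½p : ∀ p → ½ * p + ½ * p ≡ p
  ½p+½p p = trans (sym (ℚP.*-distribʳ-+ p ½ ½)) (ℚP.*-identityˡ p)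

  recip : ∀ {p} → 0ℚ < p → ℚ
  recip {p} 0<p = (1/ p) {{ℚ.>-nonZero 0<p}}

  0<recip : ∀ {p} (0<p : 0ℚ < p) → 0ℚ < recip 0<p
  0<recip {p} 0<p = ℚP.positive⁻¹ (recip 0<p) {{ℚP.1/pos⇒pos p {{positive 0<p}}}}

  *-recip : ∀ {p} (0<p : 0ℚ < p) → p * recip 0<p ≡ 1ℚ
  *-recip {p} 0<p = ℚP.*-inverseʳ p {{ℚ.>-nonZero 0<p}}

  *-recip-cancel : ∀ {p} (0<p : 0ℚ < p) q → p * (q * recip 0<p) ≡ q
  *-recip-cancel {p} 0<p q = begin-equality
    p * (q * recip 0<p)  ≡⟨ solve 3 (λ p q r → p :* (q :* r) := q :* (p :* r)) refl p q (recip 0<p) ⟩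
    q * (p * recip 0<p)  ≡⟨ cong (q *_) (*-recip 0<p) ⟩
    q * 1ℚ               ≡⟨ ℚP.*-identityʳ q ⟩
    q                    ∎

  -- The inverse, totalised by 1/0 = 0.
  inverse : ℚ → ℚ
  inverse p with p ℚP.≟ 0ℚ
  ... | yes _   = 0ℚ
  ... | no  p≢0 = (1/ p) {{ℚ.≢-nonZero p≢0}}

  inverse-*ˡ : ∀ p → p ≢ 0ℚ → inverse p * p ≡ 1ℚ
  inverse-*ˡ p p≢0 with p ℚP.≟ 0ℚ
  ... | yes p≡0 = contradiction p≡0 p≢0
  ... | no  p≢0 = ℚP.*-inverseˡ p {{ℚ.≢-nonZero p≢0}}

  module _ {δ} (0<δ : 0ℚ < δ) where

    bounded⇒≢0 : ∀ {p} → δ ≤ ∣ p ∣ → p ≢ 0ℚ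
    bounded⇒≢0 δ≤∣p∣ refl = ℚP.<-irrefl refl (ℚP.<-≤-trans 0<δ δ≤∣p∣)

    ∣inverse∣≤ : ∀ p → δ ≤ ∣ p ∣ → ∣ inverse p ∣ ≤ recip 0<δ
    ∣inverse∣≤ p δ≤∣p∣ = begin
      ∣ r ∣                  ≡⟨ *-recip-cancel 0<δ ∣ r ∣ ⟨
      δ * (∣ r ∣ * d)        ≤⟨ ℚP.*-monoʳ-≤-nonNeg (∣ r ∣ * d) {{nn}} δ≤∣p∣ ⟩
      ∣ p ∣ * (∣ r ∣ * d)    ≡⟨ solve 3 (λ p r d → p :* (r :* d) := (r :* p) :* d) refl ∣ p ∣ ∣ r ∣ d ⟩
      (∣ r ∣ * ∣ p ∣) * d    ≡⟨ cong (_* d) (ℚP.∣p*q∣≡∣p∣*∣q∣ r p) ⟨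
      ∣ r * p ∣ * d          ≡⟨ cong (λ t → ∣ t ∣ * d) (inverse-*ˡ p (bounded⇒≢0 δ≤∣p∣)) ⟩
      1ℚ * d                 ≡⟨ ℚP.*-identityˡ d ⟩
      d                      ∎
      where
      r = inverse p
      d = recip 0<δ
      nn : NonNegative (∣ r ∣ * d)
      nn = ℚP.nonNeg*nonNeg⇒nonNeg ∣ r ∣ {{nonNegative (ℚP.0≤∣p∣ r)}}
                                   d {{nonNegative (ℚP.<⇒≤ (0<recip 0<δ))}}

  p*p≤5⇒p≤3 : ∀ p → p * p ≤ 5ℚ → p ≤ 3ℚ
  p*p≤5⇒p≤3 p p²≤5 with p ℚP.≤? 3ℚ
  ... | yes p≤3 = p≤3
  ... | no  p≰3 = contradiction 9≤5 λ { (ℚ.*≤* (ℤ.+≤+ (ℕ.s≤s (ℕ.s≤s (ℕ.s≤s (ℕ.s≤s (ℕ.s≤s ()))))))) }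
    where
    3≤p = ℚP.<⇒≤ (ℚP.≰⇒> p≰3)
    0≤3 = ℚP.nonNegative⁻¹ 3ℚ
    9≤5 : + 9 ℚ./ 1 ≤ 5ℚ
    9≤5 = begin
      3ℚ * 3ℚ  ≤⟨ *-mono-≤ 0≤3 (ℚP.≤-trans 0≤3 3≤p) 3≤p 3≤p ⟩
      p * p    ≤⟨ p²≤5 ⟩
      5ℚ       ∎

  ½^ : ℕ → ℚ
  ½^ zero    = 1ℚ
  ½^ (suc n) = ½ * ½^ n

  0<½^ : ∀ n → 0ℚ < ½^ n
  0<½^ zero    = 0<1
  0<½^ (suc n) = 0<½* (0<½^ n)

  ½^≤1 : ∀ n → ½^ n ≤ 1ℚ
  ½^≤1 zero    = ℚP.≤-refl
  ½^≤1 (suc n) = begin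
    ½ * ½^ n  ≤⟨ ℚP.*-monoˡ-≤-nonNeg ½ (½^≤1 n) ⟩
    ½         ≤⟨ ℚP.≤ᵇ⇒≤ _ ⟩
    1ℚ        ∎

  abstract

    fromℕᵘ : ∀ n → ℚ.toℚᵘ (+ n ℚ./ 1) ℚᵘ.≃ ℚᵘ.mkℚᵘ (+ n) 0
    fromℕᵘ n = ℚP.toℚᵘ-fromℚᵘ (ℚᵘ.mkℚᵘ (+ n) 0)

    fromℕ-suc : ∀ n → + suc n ℚ./ 1 ≡ 1ℚ + + n ℚ./ 1
    fromℕ-suc n = ℚP.toℚᵘ-injective (ℚᵘP.≃-trans (fromℕᵘ (suc n)) (ℚᵘP.≃-sym
      (ℚᵘP.≃-trans (ℚP.toℚᵘ-homo-+ 1ℚ (+ n ℚ./ 1))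
      (ℚᵘP.≃-trans (ℚᵘP.+-congʳ (ℚ.toℚᵘ 1ℚ) (fromℕᵘ n))
      (ℚᵘ.*≡* (cong (λ t → (+ 1 ℤ.+ t) ℤ.* + 1) (ℤP.*-identityʳ (+ n))))))))

    n*½^n≤1 : ∀ n → (+ n ℚ./ 1) * ½^ n ≤ 1ℚ
    n*½^n≤1 zero    = ℚP.≤ᵇ⇒≤ _
    n*½^n≤1 (suc n) = begin
      (+ suc n ℚ./ 1) * (½ * ½^ n)            ≡⟨ cong (_* (½ * ½^ n)) (fromℕ-suc n) ⟩
      (1ℚ + + n ℚ./ 1) * (½ * ½^ n)           ≡⟨ solve 3 (λ k h p → (con 1ℚ :+ k) :* (h :* p) := h :* p :+ h :* (k :* p)) refl (+ n ℚ./ 1) ½ (½^ n) ⟩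
      ½ * ½^ n + ½ * ((+ n ℚ./ 1) * ½^ n)     ≤⟨ ℚP.+-mono-≤ (ℚP.*-monoˡ-≤-nonNeg ½ (½^≤1 n)) (ℚP.*-monoˡ-≤-nonNeg ½ (n*½^n≤1 n)) ⟩
      ½ * 1ℚ + ½ * 1ℚ                         ≡⟨ ½p+½p 1ℚ ⟩
      1ℚ                                      ∎

    1≤denominator* : ∀ ε → 0ℚ < ε → 1ℚ ≤ (+ ℚ.↧ₙ ε ℚ./ 1) * ε
    1≤denominator* ε@(mkℚ (+ zero) d c) (ℚ.*<* (ℤ.+<+ ()))
    1≤denominator* (mkℚ -[1+ _ ] d c) (ℚ.*<* ())
    1≤denominator* ε@(mkℚ (+ suc a) d c) _ = ℚP.toℚᵘ-cancel-≤
      (ℚᵘP.≤-respʳ-≃ (ℚᵘP.≃-sym (ℚᵘP.≃-trans (ℚP.toℚᵘ-homo-* (+ suc d ℚ./ 1) ε)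
                                              (ℚᵘP.*-congʳ {ℚ.toℚᵘ ε} (fromℕᵘ (suc d)))))
        (ℚᵘ.*≤* (subst₂ ℤ._≤_ l r (ℤ.+≤+ (ℕP.m≤m*n (suc d) (suc a))))))
      where
      l : + suc d ≡ + 1 ℤ.* (+ 1 ℤ.* + suc d)
      l = sym (trans (ℤP.*-identityˡ _) (ℤP.*-identityˡ _))
      r : + (suc d ℕ.* suc a) ≡ (+ suc d ℤ.* + suc a) ℤ.* + 1
      r = trans (ℤP.pos-* (suc d) (suc a)) (sym (ℤP.*-identityʳ _))

    ½^-archimedean : ∀ ε → 0ℚ < ε → ∃ λ n → ½^ n ≤ ε
    ½^-archimedean ε 0<ε = q , (begin
      ½^ q                        ≡⟨ ℚP.*-identityˡ (½^ q) ⟨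
      1ℚ * ½^ q                   ≤⟨ ℚP.*-monoʳ-≤-nonNeg (½^ q) {{nonNegative (ℚP.<⇒≤ (0<½^ q))}} (1≤denominator* ε 0<ε) ⟩
      (+ q ℚ./ 1) * ε * ½^ q      ≡⟨ solve 3 (λ k e p → k :* e :* p := k :* p :* e) refl (+ q ℚ./ 1) ε (½^ q) ⟩
      (+ q ℚ./ 1) * ½^ q * ε      ≤⟨ ℚP.*-monoʳ-≤-nonNeg ε {{nonNegative (ℚP.<⇒≤ 0<ε)}} (n*½^n≤1 q) ⟩
      1ℚ * ε                      ≡⟨ ℚP.*-identityˡ ε ⟩
      ε                           ∎)
      where
      q : ℕ
      q = ℚ.↧ₙ ε

IsCauchy : (ℕ → ℚ) → Set
IsCauchy x = ∀ ε → 0ℚ ℚ.< ε →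
  ∃ λ N → ∀ {m n} → N ℕ.≤ m → N ℕ.≤ n → ∣ x m ℚ.- x n ∣ ℚ.≤ ε

BoundedAwayFrom0 : (ℕ → ℚ) → Set
BoundedAwayFrom0 x =
  ∃ λ δ → 0ℚ ℚ.< δ × ∃ λ N → ∀ {n} → N ℕ.≤ n → δ ℚ.≤ ∣ x n ∣

module Cauchy where

  open import Data.Rational.Base using (_+_; _*_; _-_; -_; _≤_; _<_)
  open ℚP.≤-Reasoning
  open +-*-Solver
  open Rational

  EventuallyBounded : (ℕ → ℚ) → Set
  EventuallyBounded x =
    ∃ λ B → 0ℚ < B × ∃ λ N → ∀ {n} → N ℕ.≤ n → ∣ x n ∣ ≤ B

  abstract

    const-cauchy : ∀ q → IsCauchy (λ _ → q)
    const-cauchy q ε 0<ε = 0 , λ _ _ → begin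
      ∣ q - q ∣  ≡⟨ cong ∣_∣ (ℚP.+-inverseʳ q) ⟩
      0ℚ         ≤⟨ ℚP.<⇒≤ 0<ε ⟩
      ε          ∎

    +-cauchy : ∀ x y → IsCauchy x → IsCauchy y → IsCauchy (λ n → x n + y n)
    +-cauchy x y cx cy ε 0<ε with cx (½ * ε) (0<½* 0<ε) | cy (½ * ε) (0<½* 0<ε)
    ... | M , hx | N , hy = M ℕ.⊔ N , λ {m} {n} ≤m ≤n → begin
      ∣ (x m + y m) - (x n + y n) ∣    ≡⟨ cong ∣_∣ (solve 4 (λ a b c d → (a :+ b) :- (c :+ d) := (a :- c) :+ (b :- d)) refl (x m) (y m) (x n) (y n)) ⟩
      ∣ (x m - x n) + (y m - y n) ∣    ≤⟨ ∣p+q∣≤ (x m - x n) (y m - y n)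
                                            (hx (ℕP.m⊔n≤o⇒m≤o M N ≤m) (ℕP.m⊔n≤o⇒m≤o M N ≤n))
                                            (hy (ℕP.m⊔n≤o⇒n≤o M N ≤m) (ℕP.m⊔n≤o⇒n≤o M N ≤n)) ⟩
      ½ * ε + ½ * ε                    ≡⟨ ½p+½p ε ⟩
      ε                                ∎

    neg-cauchy : ∀ x → IsCauchy x → IsCauchy (λ n → - x n)
    neg-cauchy x cx ε 0<ε with cx ε 0<ε
    ... | N , hx = N , λ {m} {n} ≤m ≤n → begin
      ∣ - x m - - x n ∣    ≡⟨ cong ∣_∣ (solve 2 (λ a b → :- a :- :- b := :- (a :- b)) refl (x m) (x n)) ⟩
      ∣ - (x m - x n) ∣    ≡⟨ ℚP.∣-p∣≡∣p∣ (x m - x n) ⟩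
      ∣ x m - x n ∣        ≤⟨ hx ≤m ≤n ⟩
      ε                    ∎

    eventually-bounded : ∀ x → IsCauchy x → EventuallyBounded x
    eventually-bounded x cx with cx 1ℚ 0<1
    ... | N , hx = ∣ x N ∣ + 1ℚ , 0<1+∣ x N ∣ , N , λ {n} ≤n → begin
      ∣ x n ∣                  ≡⟨ cong ∣_∣ (solve 2 (λ a b → a := b :+ (a :- b)) refl (x n) (x N)) ⟩
      ∣ x N + (x n - x N) ∣    ≤⟨ ∣p+q∣≤ (x N) (x n - x N) ℚP.≤-refl (hx ≤n ℕP.≤-refl) ⟩
      ∣ x N ∣ + 1ℚ             ∎

    bounded-*-cauchy : ∀ x y → EventuallyBounded x → EventuallyBounded y →
      IsCauchy x → IsCauchy y → IsCauchy (λ n → x n * y n)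
    bounded-*-cauchy x y (A , 0<A , K , bx) (B , 0<B , L , by) cx cy ε 0<ε
      with cx (½ * ε * recip 0<B) (0<* (0<½* 0<ε) (0<recip 0<B))
         | cy (½ * ε * recip 0<A) (0<* (0<½* 0<ε) (0<recip 0<A))
    ... | M , hx | N , hy = (K ℕ.⊔ L) ℕ.⊔ (M ℕ.⊔ N) , λ {m} {n} ≤m ≤n → begin
      ∣ x m * y m - x n * y n ∣
        ≡⟨ cong ∣_∣ (solve 4 (λ a b c d → a :* b :- c :* d := a :* (b :- d) :+ d :* (a :- c)) refl (x m) (y m) (x n) (y n)) ⟩
      ∣ x m * (y m - y n) + y n * (x m - x n) ∣
        ≤⟨ ∣p+q∣≤ (x m * (y m - y n)) (y n * (x m - x n))
             (∣p*q∣≤ (x m) (y m - y n) (bx (K≤ ≤m)) (hy (N≤ ≤m) (N≤ ≤n)))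
             (∣p*q∣≤ (y n) (x m - x n) (by (L≤ ≤n)) (hx (M≤ ≤m) (M≤ ≤n))) ⟩
      A * (½ * ε * recip 0<A) + B * (½ * ε * recip 0<B)
        ≡⟨ cong₂ _+_ (*-recip-cancel 0<A (½ * ε)) (*-recip-cancel 0<B (½ * ε)) ⟩
      ½ * ε + ½ * ε
        ≡⟨ ½p+½p ε ⟩
      ε ∎
      where
      K≤ : ∀ {m} → (K ℕ.⊔ L) ℕ.⊔ (M ℕ.⊔ N) ℕ.≤ m → K ℕ.≤ m
      K≤ = ℕP.m⊔n≤o⇒m≤o K L ∘ ℕP.m⊔n≤o⇒m≤o (K ℕ.⊔ L) (M ℕ.⊔ N)
      L≤ : ∀ {m} → (K ℕ.⊔ L) ℕ.⊔ (M ℕ.⊔ N) ℕ.≤ m → L ℕ.≤ m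
      L≤ = ℕP.m⊔n≤o⇒n≤o K L ∘ ℕP.m⊔n≤o⇒m≤o (K ℕ.⊔ L) (M ℕ.⊔ N)
      M≤ : ∀ {m} → (K ℕ.⊔ L) ℕ.⊔ (M ℕ.⊔ N) ℕ.≤ m → M ℕ.≤ m
      M≤ = ℕP.m⊔n≤o⇒m≤o M N ∘ ℕP.m⊔n≤o⇒n≤o (K ℕ.⊔ L) (M ℕ.⊔ N)
      N≤ : ∀ {m} → (K ℕ.⊔ L) ℕ.⊔ (M ℕ.⊔ N) ℕ.≤ m → N ℕ.≤ m
      N≤ = ℕP.m⊔n≤o⇒n≤o M N ∘ ℕP.m⊔n≤o⇒n≤o (K ℕ.⊔ L) (M ℕ.⊔ N)

    *-cauchy : ∀ x y → IsCauchy x → IsCauchy y → IsCauchy (λ n → x n * y n)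
    *-cauchy x y cx cy =
      bounded-*-cauchy x y (eventually-bounded x cx) (eventually-bounded y cy) cx cy

    inverse-cauchy : ∀ x → IsCauchy x → BoundedAwayFrom0 x → IsCauchy (inverse ∘ x)
    inverse-cauchy x cx (δ , 0<δ , K , δ≤) ε 0<ε
      with cx (δ * (δ * ε)) (0<* 0<δ (0<* 0<δ 0<ε))
    ... | N , hx = K ℕ.⊔ N , λ {m} {n} ≤m ≤n →
      let a = x m
          b = x n
          δ≤a = δ≤ (ℕP.m⊔n≤o⇒m≤o K N ≤m)
          δ≤b = δ≤ (ℕP.m⊔n≤o⇒m≤o K N ≤n)
          r = inverse a
          s = inverse b
          d = recip 0<δ
      in begin
      ∣ r - s ∣
        ≡⟨ cong ∣_∣ (cong₂ _-_ (ℚP.*-identityʳ r) (ℚP.*-identityʳ s)) ⟨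
      ∣ r * 1ℚ - s * 1ℚ ∣
        ≡⟨ cong₂ (λ t u → ∣ r * t - s * u ∣) (inverse-*ˡ b (bounded⇒≢0 0<δ δ≤b)) (inverse-*ˡ a (bounded⇒≢0 0<δ δ≤a)) ⟨
      ∣ r * (s * b) - s * (r * a) ∣
        ≡⟨ cong ∣_∣ (solve 4 (λ r s a b → r :* (s :* b) :- s :* (r :* a) := (r :* s) :* (b :- a)) refl r s a b) ⟩
      ∣ (r * s) * (b - a) ∣
        ≤⟨ ∣p*q∣≤ (r * s) (b - a)
             (∣p*q∣≤ r s (∣inverse∣≤ 0<δ a δ≤a) (∣inverse∣≤ 0<δ b δ≤b))
             (hx (ℕP.m⊔n≤o⇒n≤o K N ≤n) (ℕP.m⊔n≤o⇒n≤o K N ≤m)) ⟩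
      (d * d) * (δ * (δ * ε))
        ≡⟨ solve 3 (λ d p e → (d :* d) :* (p :* (p :* e)) := (p :* d) :* ((p :* d) :* e)) refl d δ ε ⟩
      (δ * d) * ((δ * d) * ε)
        ≡⟨ cong (λ t → t * (t * ε)) (*-recip 0<δ) ⟩
      1ℚ * (1ℚ * ε)
        ≡⟨ trans (ℚP.*-identityˡ (1ℚ * ε)) (ℚP.*-identityˡ ε) ⟩
      ε ∎

-- √5 by bisection: the n-th term is the largest multiple of ½ⁿ whose
-- square is at most 5.

module √5-Approximation where

  open import Data.Rational.Base using (_+_; _*_; _-_; -_; _≤_; _<_)
  open ℚP.≤-Reasoning
  open +-*-Solver
  open Rational

  refineStep : ℚ → ℚ → ℚ
  refineStep x δ with (x + δ) * (x + δ) ℚP.≤? 5ℚ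
  ... | yes _ = x + δ
  ... | no  _ = x

  approx : ℕ → ℚ
  approx zero    = 2ℚ
  approx (suc n) = refineStep (approx n) (½^ (suc n))

  abstract

    approx²≤5 : ∀ n → approx n * approx n ≤ 5ℚ
    approx²≤5 zero    = ℚP.≤ᵇ⇒≤ _
    approx²≤5 (suc n)
      with (approx n + ½^ (suc n)) * (approx n + ½^ (suc n)) ℚP.≤? 5ℚ
    ... | yes p = p
    ... | no  _ = approx²≤5 n

    5≤upper² : ∀ n → 5ℚ ≤ (approx n + ½^ n) * (approx n + ½^ n)
    5≤upper² zero    = ℚP.≤ᵇ⇒≤ _
    5≤upper² (suc n)
      with (approx n + ½^ (suc n)) * (approx n + ½^ (suc n)) ℚP.≤? 5ℚ
    ... | yes _ = subst (λ t → 5ℚ ≤ t * t) eq (5≤upper² n)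
      where
      eq : approx n + ½^ n ≡ approx n + ½^ (suc n) + ½^ (suc n)
      eq = trans (cong (λ t → approx n + t) (sym (½p+½p (½^ n))))
                 (sym (ℚP.+-assoc (approx n) (½^ (suc n)) (½^ (suc n))))
    ... | no  p = ℚP.<⇒≤ (ℚP.≰⇒> p)

    p≤p+½^ : ∀ p n → p ≤ p + ½^ n
    p≤p+½^ p n = begin
      p          ≡⟨ ℚP.+-identityʳ p ⟨
      p + 0ℚ     ≤⟨ ℚP.+-monoʳ-≤ p (ℚP.<⇒≤ (0<½^ n)) ⟩
      p + ½^ n   ∎

    approx-step : ∀ n → approx n ≤ approx (suc n)
    approx-step n with (approx n + ½^ (suc n)) * (approx n + ½^ (suc n)) ℚP.≤? 5ℚ
    ... | yes _ = p≤p+½^ (approx n) (suc n)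
    ... | no  _ = ℚP.≤-refl

    upper-step : ∀ n → approx (suc n) + ½^ (suc n) ≤ approx n + ½^ n
    upper-step n with (approx n + ½^ (suc n)) * (approx n + ½^ (suc n)) ℚP.≤? 5ℚ
    ... | yes _ = begin
      approx n + ½^ (suc n) + ½^ (suc n)    ≡⟨ ℚP.+-assoc (approx n) (½^ (suc n)) (½^ (suc n)) ⟩
      approx n + (½ * ½^ n + ½ * ½^ n)      ≡⟨ cong (λ t → approx n + t) (½p+½p (½^ n)) ⟩
      approx n + ½^ n                       ∎
    ... | no  _ = ℚP.+-monoʳ-≤ (approx n) (begin
      ½^ (suc n)                  ≤⟨ p≤p+½^ (½^ (suc n)) (suc n) ⟩
      ½ * ½^ n + ½ * ½^ n         ≡⟨ ½p+½p (½^ n) ⟩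
      ½^ n                        ∎)

    approx-mono : ∀ N n → N ℕ.≤′ n → approx N ≤ approx n
    approx-mono N _ (ℕ.≤′-reflexive refl) = ℚP.≤-refl
    approx-mono N (suc n) (ℕ.≤′-step N≤n)   = ℚP.≤-trans (approx-mono N n N≤n) (approx-step n)

    upper-mono : ∀ N n → N ℕ.≤′ n → approx n + ½^ n ≤ approx N + ½^ N
    upper-mono N _ (ℕ.≤′-reflexive refl) = ℚP.≤-refl
    upper-mono N (suc n) (ℕ.≤′-step N≤n)   = ℚP.≤-trans (upper-step n) (upper-mono N n N≤n)

    2≤approx : ∀ n → 2ℚ ≤ approx n
    2≤approx n = approx-mono 0 n (ℕP.≤⇒≤′ ℕ.z≤n)

    difference≤ : ∀ a δ p q → a ≤ q → p ≤ a + δ → p - q ≤ δ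
    difference≤ a δ p q a≤q p≤a+δ = begin
      p - q          ≤⟨ ℚP.+-mono-≤ p≤a+δ (ℚP.neg-antimono-≤ a≤q) ⟩
      (a + δ) - a    ≡⟨ solve 2 (λ a d → (a :+ d) :- a := d) refl a δ ⟩
      δ              ∎

    ∣difference∣≤ : ∀ a δ p q → a ≤ p → a ≤ q → p ≤ a + δ → q ≤ a + δ → ∣ p - q ∣ ≤ δ
    ∣difference∣≤ a δ p q a≤p a≤q p≤ q≤ with ℚP.∣p∣≡p∨∣p∣≡-p (p - q)
    ... | inj₁ eq = ℚP.≤-trans (ℚP.≤-reflexive eq) (difference≤ a δ p q a≤q p≤)
    ... | inj₂ eq = begin
      ∣ p - q ∣    ≡⟨ eq ⟩
      - (p - q)    ≡⟨ solve 2 (λ p q → :- (p :- q) := q :- p) refl p q ⟩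
      q - p        ≤⟨ difference≤ a δ q p a≤p q≤ ⟩
      δ            ∎

    approx-cauchy : IsCauchy approx
    approx-cauchy ε 0<ε with ½^-archimedean ε 0<ε
    ... | N , ½^N≤ε = N , λ {m} {n} ≤m ≤n →
      ℚP.≤-trans (∣difference∣≤ (approx N) (½^ N) (approx m) (approx n)
                    (lower ≤m) (lower ≤n) (upper ≤m) (upper ≤n)) ½^N≤ε
      where
      lower : ∀ {n} → N ℕ.≤ n → approx N ≤ approx n
      lower {n} N≤n = approx-mono N n (ℕP.≤⇒≤′ N≤n)
      upper : ∀ {n} → N ℕ.≤ n → approx n ≤ approx N + ½^ N
      upper {n} N≤n = ℚP.≤-trans (p≤p+½^ (approx n) n) (upper-mono N n (ℕP.≤⇒≤′ N≤n))

    approx-bounded : BoundedAwayFrom0 approx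
    approx-bounded = 2ℚ , ℚP.positive⁻¹ 2ℚ , 0 , λ {n} _ → begin
      2ℚ              ≤⟨ 2≤approx n ⟩
      approx n        ≡⟨ ℚP.0≤p⇒∣p∣≡p (ℚP.≤-trans (ℚP.nonNegative⁻¹ 2ℚ) (2≤approx n)) ⟨
      ∣ approx n ∣    ∎

    ½^-antitone : ∀ N n → N ℕ.≤′ n → ½^ n ≤ ½^ N
    ½^-antitone N _ (ℕ.≤′-reflexive refl) = ℚP.≤-refl
    ½^-antitone N (suc n) (ℕ.≤′-step N≤n)   = ℚP.≤-trans (begin
      ½ * ½^ n                ≤⟨ p≤p+½^ (½ * ½^ n) (suc n) ⟩
      ½ * ½^ n + ½ * ½^ n     ≡⟨ ½p+½p (½^ n) ⟩
      ½^ n                    ∎) (½^-antitone N n N≤n)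

    approx²→5 : ∀ ε → 0ℚ < ε →
      ∃ λ N → ∀ {n} → N ℕ.≤ n → ∣ approx n * approx n - 5ℚ ∣ ≤ ε
    approx²→5 ε 0<ε with ½^-archimedean (ε * recip 0<7) (0<* 0<ε (0<recip 0<7))
      where
      0<7 : 0ℚ < 7ℚ
      0<7 = ℚP.positive⁻¹ 7ℚ
    ... | N , ½^N≤ = N , λ {n} N≤n → ∣difference∣≤ (approx n * approx n) ε (approx n * approx n) 5ℚ
      ℚP.≤-refl (approx²≤5 n)
      (begin
        approx n * approx n         ≡⟨ ℚP.+-identityʳ (approx n * approx n) ⟨
        approx n * approx n + 0ℚ    ≤⟨ ℚP.+-monoʳ-≤ (approx n * approx n) (ℚP.<⇒≤ 0<ε) ⟩
        approx n * approx n + ε     ∎)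
      (begin
        5ℚ
          ≤⟨ 5≤upper² n ⟩
        (approx n + ½^ n) * (approx n + ½^ n)
          ≡⟨ solve 2 (λ x d → (x :+ d) :* (x :+ d) := x :* x :+ (x :+ x :+ d) :* d) refl (approx n) (½^ n) ⟩
        approx n * approx n + (approx n + approx n + ½^ n) * ½^ n
          ≤⟨ ℚP.+-monoʳ-≤ (approx n * approx n) (*-mono-≤ (ℚP.<⇒≤ (0<½^ n)) (ℚP.nonNegative⁻¹ 7ℚ)
               (ℚP.+-mono-≤ (ℚP.+-mono-≤ (approx≤3 n) (approx≤3 n)) (½^≤1 n))
               (ℚP.≤-trans (½^-antitone N n (ℕP.≤⇒≤′ N≤n)) ½^N≤)) ⟩
        approx n * approx n + 7ℚ * (ε * recip 0<7)
          ≡⟨ cong (λ t → approx n * approx n + t) (*-recip-cancel 0<7 ε) ⟩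
        approx n * approx n + ε ∎)
      where
      0<7 : 0ℚ < 7ℚ
      0<7 = ℚP.positive⁻¹ 7ℚ
      approx≤3 : ∀ n → approx n ≤ 3ℚ
      approx≤3 n = p*p≤5⇒p≤3 (approx n) (approx²≤5 n)

record ℝ : Set where
  constructor mkℝ
  field
    seq    : ℕ → ℚ
    cauchy : IsCauchy seq

open ℝ public

-- Closeness of the terms rather than of the limits: it lies between
-- |x - y| < ε and |x - y| ≤ ε, which makes no difference below because
-- ε is always universally quantified.

Close : ℚ → ℝ → ℝ → Set
Close ε x y = ∃ λ N → ∀ {n} → N ℕ.≤ n → ∣ seq x n ℚ.- seq y n ∣ ℚ.≤ ε

infix  4 _≃_ _#0
infixl 6 _+_ _-_
infixl 7 _*_
infix  8 -_

_≃_ : ℝ → ℝ → Set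
x ≃ y = ∀ ε → 0ℚ ℚ.< ε → Close ε x y

_#0 : ℝ → Set
x #0 = BoundedAwayFrom0 (seq x)

fromℚ : ℚ → ℝ
fromℚ q = mkℝ (λ _ → q) (Cauchy.const-cauchy q)

fromℕ : ℕ → ℝ
fromℕ n = fromℚ (+ n ℚ./ 1)

_+_ : ℝ → ℝ → ℝ
x + y = mkℝ (λ n → seq x n ℚ.+ seq y n) (Cauchy.+-cauchy (seq x) (seq y) (cauchy x) (cauchy y))

_*_ : ℝ → ℝ → ℝ
x * y = mkℝ (λ n → seq x n ℚ.* seq y n) (Cauchy.*-cauchy (seq x) (seq y) (cauchy x) (cauchy y))

-_ : ℝ → ℝ
- x = mkℝ (λ n → ℚ.- seq x n) (Cauchy.neg-cauchy (seq x) (cauchy x))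

_-_ : ℝ → ℝ → ℝ
x - y = x + - y

inv : (x : ℝ) → x #0 → ℝ
inv x x#0 = mkℝ (Rational.inverse ∘ seq x) (Cauchy.inverse-cauchy (seq x) (cauchy x) x#0)

infixl 7 _/_[_]

_/_[_] : ℝ → (y : ℝ) → y #0 → ℝ
x / y [ y#0 ] = x * inv y y#0

*-inv : ∀ x (x#0 : x #0) → x * inv x x#0 ≃ fromℕ 1
*-inv x (δ , 0<δ , N , δ≤) ε 0<ε = N , λ {n} N≤n → begin
  ∣ seq x n ℚ.* inverse (seq x n) ℚ.- 1ℚ ∣  ≡⟨ cong (λ t → ∣ t ℚ.- 1ℚ ∣) (ℚP.*-comm (seq x n) (inverse (seq x n))) ⟩
  ∣ inverse (seq x n) ℚ.* seq x n ℚ.- 1ℚ ∣  ≡⟨ cong (λ t → ∣ t ℚ.- 1ℚ ∣) (inverse-*ˡ (seq x n) (bounded⇒≢0 0<δ (δ≤ N≤n))) ⟩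
  0ℚ                                        ≤⟨ ℚP.<⇒≤ 0<ε ⟩
  ε                                         ∎
  where
  open Rational
  open ℚP.≤-Reasoning

ℝ-rawSemiring : RawSemiring 0ℓ 0ℓ
ℝ-rawSemiring = record
  { Carrier = ℝ ; _≈_ = _≃_ ; _+_ = _+_ ; _*_ = _*_
  ; 0# = fromℕ 0 ; 1# = fromℕ 1 }

open RawSemiringDefinitions ℝ-rawSemiring public using (_^_; sum)

√5 : ℝ
√5 = mkℝ √5-Approximation.approx √5-Approximation.approx-cauchy

√5#0 : √5 #0
√5#0 = √5-Approximation.approx-bounded

√5*√5≃5 : √5 * √5 ≃ fromℕ 5
√5*√5≃5 = √5-Approximation.approx²→5

α β : ℝ
α = (fromℕ 1 + √5) * fromℚ ½
β = (fromℕ 1 - √5) * fromℚ ½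

partialSum : (ℕ → ℝ) → ℕ → ℝ
partialSum f m = sum {m} (λ k → f (toℕ k))

HasSum : (ℕ → ℝ) → ℝ → Set
HasSum f s = ∀ ε → 0ℚ ℚ.< ε →
  ∃ λ M → ∀ {m} → M ℕ.≤ m → Close ε (partialSum f m) s

IsExp : ℝ → ℝ → Set
IsExp x y = HasSum (λ k → x ^ k * fromℚ ((+ 1 ℚ./ k !) {{k !≢0}})) y

-- xᵏ kⁿ / k!, with 0⁰ = 1.
dobińskiTerm : ℝ → ℕ → ℕ → ℝ
dobińskiTerm x n k = x ^ k * fromℚ ((+ (k ℕ.^ n) ℚ./ k !) {{k !≢0}})

IsMin : ∀ {n} → Fin n → Subset n → Set
IsMin x p = x ∈ p × (∀ {y} → y ∈ p → x Fin.≤ y)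

-- [n] is represented by Fin n, that is, shifted to start from 0.

record IsPartition {n k : ℕ} (B : Vec (Subset n) k) : Set where
  field
    nonempty       : ∀ i → Nonempty (lookup B i)
    disjoint       : ∀ {i j} → i ≢ j → Empty (lookup B i ∩ lookup B j)
    covering       : ∀ x → ∃ λ i → x ∈ lookup B i
    min-increasing : ∀ {i j x y} → i Fin.< j →
                     IsMin x (lookup B i) → IsMin y (lookup B j) → x Fin.< y

IsFibonacci : ∀ {k} → Permutation′ k → Set
IsFibonacci σ = ∀ i → ℕ.∣ toℕ (σ ⟨$⟩ʳ i) - toℕ i ∣ ℕ.≤ 1

arrange : ∀ {n k} → Vec (Subset n) k → Permutation′ k → Vec (Subset n) k
arrange B σ = tabulate (λ i → lookup B (σ ⟨$⟩ʳ i))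

IsFibonacciOrderedPartition : ∀ {n k} → Vec (Subset n) k → Set
IsFibonacciOrderedPartition C =
  ∃ λ B → ∃ λ σ → IsPartition B × IsFibonacci σ × C ≡ arrange B σ

-- The refinement makes the proof irrelevant, so that arrangements are
-- counted rather than pairs of a partition and a permutation.

FibonacciOrderedPartition : ℕ → Set
FibonacciOrderedPartition n =
  ∃ λ k → Refinement (Vec (Subset n) k) IsFibonacciOrderedPartition

IsFibonacciFubini : ℕ → ℕ → Set
IsFibonacciFubini n F = Fin F ↔ FibonacciOrderedPartition n

{-# OPTIONS --safe #-}

-- Removing the elements of [n] one at a time shows that the number G(n,j) of
-- ways to distribute n elements when j blocks are already open, and then to
-- arrange all blocks by a Fibonacci permutation, satisfies
-- G(n+1,j) = j G(n,j) + G(n,j+1); a Fibonacci permutation is a sequence of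
-- fixed points and adjacent transpositions, so G(0,j) = Fib(j+1).
-- Since (j+k)ⁿ⁺¹ = j (j+k)ⁿ + k (j+k)ⁿ, the series Σ xᵏ (j+k)ⁿ / k! equals
-- T(n,j) eˣ with T(0,j) = 1 and T(n+1,j) = j T(n,j) + x T(n,j+1).
-- Binet's formula says that √5 G(n,j) = αʲ⁺¹ T(n,j)(α) - βʲ⁺¹ T(n,j)(β) for
-- n = 0, and both recursions propagate it to all n; the claim is j = 0.
module Submission where

open import Algebra.Bundles using (CommutativeRing; CommutativeSemiring; Semiring)
import Algebra.Definitions.RawSemiring
import Algebra.Properties.Monoid.Sum
import Algebra.Properties.Semiring.Mult
import Algebra.Solver.Ring.NaturalCoefficients.Default
open import Algebra.Structures using (IsCommutativeRing)
open import Data.Bool.Properties using () renaming (_≟_ to _≟ᵇ_)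
open import Data.Fin.Base as Fin using (Fin; zero; suc; toℕ; fromℕ<; inject≤)
open import Data.Fin.Permutation as Perm using (Permutation′; _⟨$⟩ʳ_; _⟨$⟩ˡ_; lift₀; remove; transpose; _∘ₚ_)
import Data.Fin.Properties as FinP
open import Data.Fin.Subset using (Subset; _∈_; inside; outside)
import Data.Fin.Subset.Properties as SubsetP
open import Data.Integer.Base as ℤ using (+_)
import Data.Integer.Properties as ℤP
import Data.Irrelevant as Irrelevant
open import Data.Nat.Base as ℕ using (ℕ; zero; suc; _!)
open import Data.Nat.Properties as ℕP using (_!≢0)
open import Data.Product.Base using (Σ; ∃; _×_; _,_; proj₁; proj₂)
open import Data.Product.Function.NonDependent.Propositional using (_×-↔_)
import Data.Product.Properties as ProductP
open import Data.Rational.Base as ℚ using (ℚ; 0ℚ; 1ℚ; ½; ∣_∣)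
import Data.Rational.Properties as ℚP
open import Data.Rational.Solver using (module +-*-Solver)
import Data.Rational.Unnormalised.Base as ℚᵘ
import Data.Rational.Unnormalised.Properties as ℚᵘP
open import Data.Refinement.Base using (Refinement) renaming (_,_ to _because_)
open import Data.Sum.Base using (_⊎_; inj₁; inj₂; [_,_]′)
open import Data.Sum.Function.Propositional using (_⊎-↔_)
open import Data.Vec.Base using (Vec; _∷_; lookup; tabulate; here; there)
import Data.Vec.Properties as VecP
import Defs
open import Function.Base using (_∘_; case_of_)
open import Function.Bundles using (_↔_; Inverse; mk↔ₛ′)
open import Function.Construct.Composition using (_↔-∘_)
open import Function.Construct.Identity using (↔-id)
open import Level using (0ℓ)
open import Relation.Binary.Definitions using (DecidableEquality; tri<; tri≈; tri>)
import Relation.Binary.PropositionalEquality as ≡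
import Relation.Binary.Reasoning.Setoid
open import Relation.Nullary using (does; yes; no; contradiction)
open import Relation.Nullary.Decidable using (recompute; dec-true)

-- What is counted are arrangements, not pairs of a partition and a permutation, so the pair must be
-- recoverable from the arrangement. This rests on the listing by increasing minima: the only
-- relabelling between two such listings of the same blocks is the identity.
--
-- On the analytic side the Dobiński series is never estimated. Its convergence is inherited from
-- the exponential series through n linear steps, so the only series estimates concern eˣ itself.
-- That limit is taken along the diagonal of the partial sums, which is possible because the
-- approximations of α and β are bounded at every index and not just eventually. Dividing by it
-- needs explicit lower bounds: 1 for α, where all terms are nonnegative, and 1/12 for β, where the
-- terms alternate in sign.

fibonacci : ℕ → ℕ
fibonacci 0             = 0
fibonacci 1             = 1
fibonacci (suc (suc n)) = fibonacci (suc n) ℕ.+ fibonacci n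

fibonacciFubini : ℕ → ℕ → ℕ
fibonacciFubini zero    j = fibonacci (suc j)
fibonacciFubini (suc n) j = j ℕ.* fibonacciFubini n j ℕ.+ fibonacciFubini n (suc j)

-- Binet's formula and Touchard polynomials over a commutative semiring

module Touchard {c ℓ} (R : CommutativeSemiring c ℓ) where

  open CommutativeSemiring R
  open Algebra.Definitions.RawSemiring rawSemiring using (_^_; sum) renaming (_×_ to _·_)
  open Algebra.Properties.Semiring.Mult semiring using (×-homo-+; ×1-homo-*)
  open Algebra.Properties.Monoid.Sum +-monoid using (sum-cong-≋)
  open Algebra.Solver.Ring.NaturalCoefficients.Default R using (solve; _:+_; _:*_; _:=_; con)
  open Relation.Binary.Reasoning.Setoid setoid

  ⟦_⟧ : ℕ → Carrier
  ⟦ n ⟧ = n · 1#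

  -- For j = 0 this is the Touchard polynomial, whose coefficients are the Stirling numbers of the
  -- second kind; general j gives the r-Bell polynomials with r = j.
  touchard : Carrier → ℕ → ℕ → Carrier
  touchard x zero    j = 1#
  touchard x (suc n) j = ⟦ j ⟧ * touchard x n j + x * touchard x n (suc j)

  -- With d = a − b, and both sides moved so that no subtraction occurs.
  module _ (a b d : Carrier) (d+b≈a : d + b ≈ a) (a²≈a+1 : a * a ≈ a + 1#) (b²≈b+1 : b * b ≈ b + 1#) where

    -- Both sides satisfy the Fibonacci recurrence in j, because a and b are roots of x² = x + 1.
    -- The case j = 1 is the hypothesis `d+b≈a`.
    binet : ∀ j → d * ⟦ fibonacci j ⟧ + b ^ j ≈ a ^ j
    binet 0 = solve 1 (λ d → d :* con 0 :+ con 1 := con 1) refl d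
    binet 1 = begin
      d * (1# + 0#) + b * 1#  ≈⟨ solve 2 (λ d b → d :* (con 1 :+ con 0) :+ b :* con 1 := (d :+ b) :* con 1) refl d b ⟩
      (d + b) * 1#            ≈⟨ *-congʳ d+b≈a ⟩
      a * 1#                  ∎
    binet (suc (suc j)) = begin
      d * ⟦ fibonacci (suc j) ℕ.+ fibonacci j ⟧ + b * (b * b ^ j)
        ≈⟨ +-congʳ (*-congˡ (×-homo-+ 1# (fibonacci (suc j)) (fibonacci j))) ⟩
      d * (F₁ + F₀) + b * (b * b ^ j)
        ≈⟨ +-congˡ (step b b²≈b+1) ⟩
      d * (F₁ + F₀) + (b ^ suc j + b ^ j)
        ≈⟨ solve 5 (λ d F₁ F₀ p q → d :* (F₁ :+ F₀) :+ (p :+ q) := (d :* F₁ :+ p) :+ (d :* F₀ :+ q)) refl d F₁ F₀ (b ^ suc j) (b ^ j) ⟩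
      (d * F₁ + b ^ suc j) + (d * F₀ + b ^ j)
        ≈⟨ +-cong (binet (suc j)) (binet j) ⟩
      a ^ suc j + a ^ j
        ≈⟨ step a a²≈a+1 ⟨
      a * (a * a ^ j) ∎
      where
      F₁ = ⟦ fibonacci (suc j) ⟧
      F₀ = ⟦ fibonacci j ⟧
      step : ∀ x → x * x ≈ x + 1# → x * (x * x ^ j) ≈ x ^ suc j + x ^ j
      step x x²≈x+1 = begin
        x * (x * x ^ j)        ≈⟨ *-assoc x x (x ^ j) ⟨
        x * x * x ^ j          ≈⟨ *-congʳ x²≈x+1 ⟩
        (x + 1#) * x ^ j       ≈⟨ solve 2 (λ x p → (x :+ con 1) :* p := x :* p :+ p) refl x (x ^ j) ⟩
        x * x ^ j + x ^ j      ∎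

    -- The power absorbs the factor x of the Touchard recursion: x^(j+1) · x T(n,j+1) = x^(j+2)
    -- T(n,j+1). After this all three summands obey the same recursion, with coefficients j and 1.
    fibonacciFubini-touchard : ∀ n j →
      d * ⟦ fibonacciFubini n j ⟧ + b ^ suc j * touchard b n j ≈ a ^ suc j * touchard a n j
    fibonacciFubini-touchard zero j = begin
      d * ⟦ fibonacci (suc j) ⟧ + b ^ suc j * 1#  ≈⟨ +-congˡ (*-identityʳ _) ⟩
      d * ⟦ fibonacci (suc j) ⟧ + b ^ suc j       ≈⟨ binet (suc j) ⟩
      a ^ suc j                                   ≈⟨ *-identityʳ _ ⟨
      a ^ suc j * 1#                              ∎
    fibonacciFubini-touchard (suc n) j = begin
      d * ⟦ j ℕ.* f ℕ.+ g ⟧ + b ^ suc j * touchard b (suc n) j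
        ≈⟨ +-congʳ (*-congˡ (trans (×-homo-+ 1# (j ℕ.* f) g) (+-congʳ (×1-homo-* j f)))) ⟩
      d * (⟦ j ⟧ * ⟦ f ⟧ + ⟦ g ⟧) + b ^ suc j * (⟦ j ⟧ * touchard b n j + b * touchard b n (suc j))
        ≈⟨ solve 8 (λ d j f g p t b u → d :* (j :* f :+ g) :+ p :* (j :* t :+ b :* u)
             := j :* (d :* f :+ p :* t) :+ (d :* g :+ b :* p :* u))
             refl d ⟦ j ⟧ ⟦ f ⟧ ⟦ g ⟧ (b ^ suc j) (touchard b n j) b (touchard b n (suc j)) ⟩
      ⟦ j ⟧ * (d * ⟦ f ⟧ + b ^ suc j * touchard b n j) + (d * ⟦ g ⟧ + b ^ suc (suc j) * touchard b n (suc j))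
        ≈⟨ +-cong (*-congˡ (fibonacciFubini-touchard n j)) (fibonacciFubini-touchard n (suc j)) ⟩
      ⟦ j ⟧ * (a ^ suc j * touchard a n j) + a ^ suc (suc j) * touchard a n (suc j)
        ≈⟨ solve 5 (λ j p t a u → j :* (p :* t) :+ a :* p :* u := p :* (j :* t :+ a :* u))
             refl ⟦ j ⟧ (a ^ suc j) (touchard a n j) a (touchard a n (suc j)) ⟩
      a ^ suc j * touchard a (suc n) j ∎
      where
      f = fibonacciFubini n j
      g = fibonacciFubini n (suc j)

  ∑ : (ℕ → Carrier) → ℕ → Carrier
  ∑ f m = sum {m} (λ k → f (toℕ k))

  ∑-cong : ∀ f g → (∀ k → f k ≈ g k) → ∀ m → ∑ f m ≈ ∑ g m
  ∑-cong f g f≈g m = sum-cong-≋ {m} (f≈g ∘ toℕ)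

  ∑-linear : ∀ c d f g h → (∀ k → h k ≈ c * f k + d * g k) → ∀ m → ∑ h m ≈ c * ∑ f m + d * ∑ g m
  ∑-linear c d f g h h≈ zero    = solve 2 (λ c d → con 0 := c :* con 0 :+ d :* con 0) refl c d
  ∑-linear c d f g h h≈ (suc m) = begin
    h 0 + ∑ (h ∘ suc) m
      ≈⟨ +-cong (h≈ 0) (∑-linear c d (f ∘ suc) (g ∘ suc) (h ∘ suc) (h≈ ∘ suc) m) ⟩
    c * f 0 + d * g 0 + (c * ∑ (f ∘ suc) m + d * ∑ (g ∘ suc) m)
      ≈⟨ solve 6 (λ c d a b p q → c :* a :+ d :* b :+ (c :* p :+ d :* q) := c :* (a :+ p) :+ d :* (b :+ q))
           refl c d (f 0) (g 0) (∑ (f ∘ suc) m) (∑ (g ∘ suc) m) ⟩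
    c * ∑ f (suc m) + d * ∑ g (suc m) ∎

  module _ (x : Carrier) (w : ℕ → Carrier) (w-suc : ∀ k → ⟦ suc k ⟧ * w (suc k) ≈ w k) where

    -- `w k` stands for 1/k!. The law `w-suc` is all that the recursion needs, so it can be proved
    -- without division.
    term : ℕ → ℕ → ℕ → Carrier
    term n j k = x ^ k * (⟦ (j ℕ.+ k) ℕ.^ n ⟧ * w k)

    -- (j + k)ⁿ⁺¹ = j (j + k)ⁿ + k (j + k)ⁿ, and the factor k shifts the weights.
    term-suc : ∀ n j k → term (suc n) j (suc k) ≈ ⟦ j ⟧ * term n j (suc k) + x * term n (suc j) k
    term-suc n j k = begin
      x * p * (⟦ (j ℕ.+ suc k) ℕ.* q ⟧ * w (suc k))
        ≈⟨ *-congˡ (*-congʳ (trans (×1-homo-* (j ℕ.+ suc k) q) (*-congʳ (×-homo-+ 1# j (suc k))))) ⟩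
      x * p * ((⟦ j ⟧ + ⟦ suc k ⟧) * ⟦ q ⟧ * w (suc k))
        ≈⟨ solve 6 (λ x p j s q v → x :* p :* ((j :+ s) :* q :* v) := j :* (x :* p :* (q :* v)) :+ x :* (p :* (q :* (s :* v))))
             refl x p ⟦ j ⟧ ⟦ suc k ⟧ ⟦ q ⟧ (w (suc k)) ⟩
      ⟦ j ⟧ * (x * p * (⟦ q ⟧ * w (suc k))) + x * (p * (⟦ q ⟧ * (⟦ suc k ⟧ * w (suc k))))
        ≈⟨ +-congˡ (*-congˡ (*-congˡ (*-cong (reflexive (≡.cong (λ t → ⟦ t ℕ.^ n ⟧) (ℕP.+-suc j k))) (w-suc k)))) ⟩
      ⟦ j ⟧ * term n j (suc k) + x * term n (suc j) k ∎
      where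
      p = x ^ k
      q = (j ℕ.+ suc k) ℕ.^ n

    -- The index shift in the second series shortens its partial sum by one term. The term k = 0
    -- contributes nothing to that series, since (j + 0)ⁿ⁺¹ is already j (j + 0)ⁿ.
    ∑-term-suc : ∀ n j m → ∑ (term (suc n) j) (suc m) ≈ ⟦ j ⟧ * ∑ (term n j) (suc m) + x * ∑ (term n (suc j)) m
    ∑-term-suc n j m = begin
      term (suc n) j 0 + ∑ (term (suc n) j ∘ suc) m
        ≈⟨ +-cong head (∑-linear ⟦ j ⟧ x (term n j ∘ suc) (term n (suc j)) (term (suc n) j ∘ suc) (term-suc n j) m) ⟩
      ⟦ j ⟧ * term n j 0 + (⟦ j ⟧ * ∑ (term n j ∘ suc) m + x * ∑ (term n (suc j)) m)
        ≈⟨ solve 5 (λ j a p x q → j :* a :+ (j :* p :+ x :* q) := j :* (a :+ p) :+ x :* q)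
             refl ⟦ j ⟧ (term n j 0) (∑ (term n j ∘ suc) m) x (∑ (term n (suc j)) m) ⟩
      ⟦ j ⟧ * ∑ (term n j) (suc m) + x * ∑ (term n (suc j)) m ∎
      where
      head : term (suc n) j 0 ≈ ⟦ j ⟧ * term n j 0
      head = begin
        1# * (⟦ (j ℕ.+ 0) ℕ.* (j ℕ.+ 0) ℕ.^ n ⟧ * w 0)
          ≈⟨ *-congˡ (*-congʳ (trans (×1-homo-* (j ℕ.+ 0) _) (*-congʳ (reflexive (≡.cong ⟦_⟧ (ℕP.+-identityʳ j)))))) ⟩
        1# * (⟦ j ⟧ * ⟦ (j ℕ.+ 0) ℕ.^ n ⟧ * w 0)
          ≈⟨ solve 3 (λ j q v → con 1 :* (j :* q :* v) := j :* (con 1 :* (q :* v))) refl ⟦ j ⟧ _ (w 0) ⟩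
        ⟦ j ⟧ * term n j 0 ∎

open Defs
open Rational using
  (½^; 0<½^; ½p+½p; 0<½*; 0<*; recip; 0<recip; *-recip-cancel; ∣p+q∣≤; ∣p*q∣≤; ½^-archimedean; *-mono-≤; 0<1;
   fromℕ-suc; fromℕᵘ; 2ℚ; 3ℚ; 5ℚ)
open √5-Approximation using (approx; approx²≤5; 2≤approx)
open ≡
open +-*-Solver using (solve; _:+_; _:*_; _:-_; :-_; _:=_; con)

-- Enumerating a type whose membership proofs are irrelevant

module _ {A : ℕ → Set} (_≟_ : ∀ {k} → DecidableEquality (A k)) (P : ∀ {k} → A k → Set) where

  private
    pack : (x : ∃ A) → .(P (proj₂ x)) → ∃ λ k → Refinement (A k) P
    pack (k , a) p = k , (a because Irrelevant.[ p ])

    pack-cong : ∀ {x y} → x ≡ y → .(p : P (proj₂ x)) .(q : P (proj₂ y)) → pack x p ≡ pack y q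
    pack-cong refl _ _ = refl

  Fin↔∃Refinement : ∀ {m} (f : Fin m → ∃ A) → (∀ {i j} → f i ≡ f j → i ≡ j) →
    (∀ i → P (proj₂ (f i))) → (∀ {k} (a : A k) → P a → ∃ λ i → f i ≡ (k , a)) →
    Fin m ↔ ∃ λ k → Refinement (A k) P
  Fin↔∃Refinement {m} f f-injective sound complete = mk↔ₛ′
    (λ i → pack (f i) (sound i))
    (λ { (k , (a because Irrelevant.[ p ])) → proj₁ (search a p) })
    (λ { (k , (a because Irrelevant.[ p ])) → pack-cong (proj₂ (search a p)) _ p })
    (λ i → f-injective (proj₂ (search (proj₂ (f i)) (sound i))))
    where
    -- The proof of P a is irrelevant, but finding i is decidable.
    search : ∀ {k} (a : A k) → .(P a) → ∃ λ i → f i ≡ (k , a)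
    search a p = recompute (FinP.any? λ i → ProductP.≡-dec ℕP._≟_ _≟_ (f i) (_ , a)) (complete a p)

-- Fibonacci permutations

data Swaps : ℕ → Set where
  nil  : Swaps 0
  fix  : ∀ {k} → Swaps k → Swaps (suc k)
  swap : ∀ {k} → Swaps k → Swaps (suc (suc k))

swapsPerm : ∀ {k} → Swaps k → Permutation′ k
swapsPerm nil      = Perm.id
swapsPerm (fix s)  = lift₀ (swapsPerm s)
swapsPerm (swap s) = Perm.swap (swapsPerm s)

swapsPerm-fibonacci : ∀ {k} (s : Swaps k) → IsFibonacci (swapsPerm s)
swapsPerm-fibonacci (fix s)  zero          = ℕ.z≤n
swapsPerm-fibonacci (fix s)  (suc i)       = swapsPerm-fibonacci s i
swapsPerm-fibonacci (swap s) zero          = ℕP.≤-refl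
swapsPerm-fibonacci (swap s) (suc zero)    = ℕP.≤-refl
swapsPerm-fibonacci (swap s) (suc (suc i)) = swapsPerm-fibonacci s i

swapsPerm-injective : ∀ {k} (s t : Swaps k) → swapsPerm s Perm.≈ swapsPerm t → s ≡ t
swapsPerm-injective nil      nil      _  = refl
swapsPerm-injective (fix s)  (fix t)  eq = cong fix (swapsPerm-injective s t λ i → FinP.suc-injective (eq (suc i)))
swapsPerm-injective (fix s)  (swap t) eq with () ← eq zero
swapsPerm-injective (swap s) (fix t)  eq with () ← eq zero
swapsPerm-injective (swap s) (swap t) eq = cong swap (swapsPerm-injective s t λ i →
  FinP.suc-injective (FinP.suc-injective (eq (suc (suc i)))))

fibonacci-cong : ∀ {k} {σ ρ : Permutation′ k} → σ Perm.≈ ρ → IsFibonacci σ → IsFibonacci ρ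
fibonacci-cong eq fib i = subst (λ j → ℕ.∣ toℕ j - toℕ i ∣ ℕ.≤ 1) (eq i) (fib i)

-- The image of 0 is 0 or 1. If it is 1, then the preimage of 0 is also within distance 1 of 0 but
-- is not 0 itself, so it is 1.
fibonacci-head : ∀ {k} (σ : Permutation′ (suc (suc k))) → IsFibonacci σ →
  σ ⟨$⟩ʳ zero ≡ zero ⊎ (σ ⟨$⟩ʳ zero ≡ suc zero × σ ⟨$⟩ʳ suc zero ≡ zero)
fibonacci-head σ fib with σ ⟨$⟩ʳ zero in eq | fib zero
... | zero        | _              = inj₁ refl
... | suc (suc _) | ℕ.s≤s ()
... | suc zero    | _ with σ ⟨$⟩ˡ zero in eq′ | fib (σ ⟨$⟩ˡ zero)
...   | zero     | _ with () ← trans (sym eq) (trans (cong (σ ⟨$⟩ʳ_) (sym eq′)) (Perm.inverseʳ σ))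
...   | suc zero | _ = inj₂ (refl , trans (cong (σ ⟨$⟩ʳ_) (sym eq′)) (Perm.inverseʳ σ))
...   | suc (suc i) | near with ℕ.s≤s () ←
  subst (λ j → ℕ.∣ toℕ j - suc (suc (toℕ i)) ∣ ℕ.≤ 1) (trans (cong (σ ⟨$⟩ʳ_) (sym eq′)) (Perm.inverseʳ σ)) near

-- Precomposing with the transposition of 0 and 1 turns the swapped pair into two fixed points,
-- which are then removed one after the other.
removeSwap : ∀ {k} (σ : Permutation′ (suc (suc k))) → σ ⟨$⟩ʳ zero ≡ suc zero → σ ⟨$⟩ʳ suc zero ≡ zero →
  ∃ λ (ρ : Permutation′ k) → ∀ i → suc (suc (ρ ⟨$⟩ʳ i)) ≡ σ ⟨$⟩ʳ suc (suc i)
removeSwap σ σ0≡1 σ1≡0 = remove zero (remove zero ρ) , λ i → trans (cong suc (ρ′≈ (suc i))) (ρ≈ (suc (suc i)))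
  where
  ρ   = transpose zero (suc zero) ∘ₚ σ
  ρ≈  = Perm.lift₀-remove ρ σ1≡0
  ρ′≈ = Perm.lift₀-remove (remove zero ρ) (FinP.suc-injective (trans (ρ≈ (suc zero)) σ0≡1))

IsSwaps : ∀ {k} → Permutation′ k → Set
IsSwaps σ = ∃ λ s → swapsPerm s Perm.≈ σ

fix-isSwaps : ∀ {k} (σ : Permutation′ (suc k)) → σ ⟨$⟩ʳ zero ≡ zero → IsSwaps (remove zero σ) → IsSwaps σ
fix-isSwaps σ σ0≡0 (s , s≈) = fix s , λ i →
  trans (Perm.lift₀-cong (swapsPerm s) (remove zero σ) s≈ i) (Perm.lift₀-remove σ σ0≡0 i)

swap-isSwaps : ∀ {k} (σ : Permutation′ (suc (suc k))) → σ ⟨$⟩ʳ zero ≡ suc zero → σ ⟨$⟩ʳ suc zero ≡ zero →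
  (ρ : Permutation′ k) → (∀ i → suc (suc (ρ ⟨$⟩ʳ i)) ≡ σ ⟨$⟩ʳ suc (suc i)) → IsSwaps ρ → IsSwaps σ
swap-isSwaps σ σ0≡1 σ1≡0 ρ ρ≈ (s , s≈) = swap s , λ
  { zero          → sym σ0≡1
  ; (suc zero)    → sym σ1≡0
  ; (suc (suc i)) → trans (cong (λ j → suc (suc j)) (s≈ i)) (ρ≈ i)
  }

swapsPerm-complete : ∀ {k} (σ : Permutation′ k) → IsFibonacci σ → IsSwaps σ
swapsPerm-complete {zero}        σ fib = nil , λ ()
swapsPerm-complete {suc zero}    σ fib with σ ⟨$⟩ʳ zero in σ0≡0
... | zero = fix nil , λ { zero → sym σ0≡0 }
swapsPerm-complete {suc (suc k)} σ fib = [
  (λ σ0≡0 → fix-isSwaps σ σ0≡0 (swapsPerm-complete (remove zero σ)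
    (fibonacci-cong {σ = σ} {lift₀ (remove zero σ)} (sym ∘ Perm.lift₀-remove σ σ0≡0) fib ∘ suc))) ,
  (λ (σ0≡1 , σ1≡0) → let ρ , ρ≈ = removeSwap σ σ0≡1 σ1≡0 in
    swap-isSwaps σ σ0≡1 σ1≡0 ρ ρ≈ (swapsPerm-complete ρ λ i →
      subst (λ j → ℕ.∣ toℕ j - suc (suc (toℕ i)) ∣ ℕ.≤ 1) (sym (ρ≈ i)) (fib (suc (suc i))))) ]′
  (fibonacci-head σ fib)

-- Set partitions

-- Growth n j k describes the ways to distribute n further elements when
-- j blocks are already open, ending with k blocks.
data Growth : ℕ → ℕ → ℕ → Set where
  done : ∀ {k} → Growth 0 k k
  old  : ∀ {n j k} → Fin j → Growth n j k → Growth (suc n) j k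
  new  : ∀ {n j k} → Growth n (suc j) k → Growth (suc n) j k

growth⇒≤ : ∀ {n j k} → Growth n j k → j ℕ.≤ k
growth⇒≤ done      = ℕP.≤-refl
growth⇒≤ (old _ c) = growth⇒≤ c
growth⇒≤ (new c)   = ℕP.<⇒≤ (growth⇒≤ c)

-- A new block receives the number j, the least one not in use, so numbers follow the order of first
-- appearance. For `new c`, the bound `growth⇒≤ c` reads j < k.
label : ∀ {n j k} → Growth n j k → Fin n → Fin k
label (old i c) zero    = inject≤ i (growth⇒≤ c)
label (old i c) (suc x) = label c x
label (new c)   zero    = fromℕ< (growth⇒≤ c)
label (new c)   (suc x) = label c x

-- Restricted growth, for labels below j being already in use.
record IsGrowing {n k : ℕ} (j : ℕ) (f : Fin n → Fin k) : Set where
  field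
    surjective : ∀ i → j ℕ.≤ toℕ i → ∃ λ x → f x ≡ i
    restricted : ∀ {i} x → j ℕ.≤ toℕ i → i Fin.< f x → ∃ λ y → y Fin.< x × f y ≡ i

open IsGrowing

label-growing : ∀ {n j k} (c : Growth n j k) → IsGrowing j (label c)
label-growing (done {k}) .surjective i k≤i = contradiction (FinP.toℕ<n i) (ℕP.≤⇒≯ k≤i)
label-growing (done {k}) .restricted ()
label-growing (old o c) .surjective i j≤i with x , eq ← label-growing c .surjective i j≤i = suc x , eq
label-growing (old o c) .restricted zero j≤i i<o = contradiction
  (ℕP.<-trans (subst (_ ℕ.<_) (FinP.toℕ-inject≤ o (growth⇒≤ c)) i<o) (FinP.toℕ<n o)) (ℕP.≤⇒≯ j≤i)
label-growing (old o c) .restricted (suc x) j≤i i<fx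
  with y , y<x , eq ← label-growing c .restricted x j≤i i<fx = suc y , ℕ.s≤s y<x , eq
label-growing {j = j} (new c) .surjective i j≤i with j ℕP.≟ toℕ i
... | yes refl = zero , FinP.fromℕ<-toℕ i (growth⇒≤ c)
... | no j≢i with x , eq ← label-growing c .surjective i (ℕP.≤∧≢⇒< j≤i j≢i) = suc x , eq
label-growing (new c) .restricted zero j≤i i<j =
  contradiction (subst (_ ℕ.<_) (FinP.toℕ-fromℕ< (growth⇒≤ c)) i<j) (ℕP.≤⇒≯ j≤i)
label-growing {j = j} (new c) .restricted {i} (suc x) j≤i i<fx with j ℕP.≟ toℕ i
... | yes refl = zero , ℕ.s≤s ℕ.z≤n , FinP.fromℕ<-toℕ i (growth⇒≤ c)
... | no j≢i with y , y<x , eq ← label-growing c .restricted x (ℕP.≤∧≢⇒< j≤i j≢i) i<fx =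
  suc y , ℕ.s≤s y<x , eq

growing-tail : ∀ {n k j} j′ (f : Fin (suc n) → Fin k) → j ℕ.≤ j′ → toℕ (f zero) ℕ.< j′ →
  IsGrowing j f → IsGrowing j′ (f ∘ suc)
growing-tail j′ f j≤j′ f0<j′ g .surjective i j′≤i with g .surjective i (ℕP.≤-trans j≤j′ j′≤i)
... | zero  , refl = contradiction f0<j′ (ℕP.≤⇒≯ j′≤i)
... | suc x , eq   = x , eq
growing-tail j′ f j≤j′ f0<j′ g .restricted x j′≤i i<fx with g .restricted (suc x) (ℕP.≤-trans j≤j′ j′≤i) i<fx
... | zero  , _          , refl = contradiction f0<j′ (ℕP.≤⇒≯ j′≤i)
... | suc y , ℕ.s≤s y<x , eq   = y , y<x , eq

label-complete : ∀ {n j k} (f : Fin n → Fin k) → j ℕ.≤ k → IsGrowing j f →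
  ∃ λ (c : Growth n j k) → label c ≗ f
label-complete {zero} {j} {k} f j≤k g with j ℕP.≟ k
... | yes refl = done , λ ()
-- With j < k the label j would still have to occur, but no element is left to carry it.
... | no j≢k with () ← proj₁ (g .surjective (fromℕ< (ℕP.≤∧≢⇒< j≤k j≢k))
                               (ℕP.≤-reflexive (sym (FinP.toℕ-fromℕ< (ℕP.≤∧≢⇒< j≤k j≢k)))))
label-complete {suc n} {j} {k} f j≤k g with toℕ (f zero) ℕP.<? j
... | yes f0<j =
  let c , eq = label-complete (f ∘ suc) j≤k (growing-tail j f ℕP.≤-refl f0<j g)
  in old (fromℕ< f0<j) c , λ
    { zero    → FinP.toℕ-injective (trans (FinP.toℕ-inject≤ _ (growth⇒≤ c)) (FinP.toℕ-fromℕ< f0<j))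
    ; (suc x) → eq x }
... | no f0≮j =
  let c , eq = label-complete (f ∘ suc) j<k (growing-tail (suc j) f (ℕP.n≤1+n j) (ℕP.≤-reflexive (cong suc f0≡j)) g)
  in new c , λ
    { zero    → FinP.toℕ-injective (trans (FinP.toℕ-fromℕ< (growth⇒≤ c)) (sym f0≡j))
    ; (suc x) → eq x }
  where
  -- A head label above j would require an element before the head that carries label j.
  f0≤j : toℕ (f zero) ℕ.≤ j
  f0≤j = ℕP.≮⇒≥ λ j<f0 →
    let j<k′ = ℕP.<-trans j<f0 (FinP.toℕ<n (f zero))
    in case g .restricted {fromℕ< j<k′} zero (ℕP.≤-reflexive (sym (FinP.toℕ-fromℕ< j<k′)))
              (subst (ℕ._< toℕ (f zero)) (sym (FinP.toℕ-fromℕ< j<k′)) j<f0)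
       of λ { (_ , () , _) }
  f0≡j : toℕ (f zero) ≡ j
  f0≡j = ℕP.≤-antisym f0≤j (ℕP.≮⇒≥ f0≮j)
  j<k : j ℕ.< k
  j<k = subst (ℕ._< k) f0≡j (FinP.toℕ<n (f zero))

label-injective : ∀ {n j k} (c d : Growth n j k) → label c ≗ label d → c ≡ d
label-injective done      done      _  = refl
label-injective (old i c) (old l d) eq = cong₂ old
  (FinP.toℕ-injective (trans (sym (FinP.toℕ-inject≤ i (growth⇒≤ c)))
    (trans (cong toℕ (eq zero)) (FinP.toℕ-inject≤ l (growth⇒≤ d)))))
  (label-injective c d (eq ∘ suc))
label-injective (old i c) (new d)   eq = contradiction (FinP.toℕ<n i) (ℕP.≤⇒≯ (ℕP.≤-reflexive
  (trans (sym (FinP.toℕ-fromℕ< (growth⇒≤ d)))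
    (trans (cong toℕ (sym (eq zero))) (FinP.toℕ-inject≤ i (growth⇒≤ c))))))
label-injective (new c)   (old i d) eq = contradiction (FinP.toℕ<n i) (ℕP.≤⇒≯ (ℕP.≤-reflexive
  (trans (sym (FinP.toℕ-fromℕ< (growth⇒≤ c)))
    (trans (cong toℕ (eq zero)) (FinP.toℕ-inject≤ i (growth⇒≤ d))))))
label-injective (new c)   (new d)   eq = cong new (label-injective c d (eq ∘ suc))

blocks : ∀ {n k} → (Fin n → Fin k) → Vec (Subset n) k
blocks f = tabulate λ i → tabulate λ x → does (f x FinP.≟ i)

lookup-blocks : ∀ {n k} (f : Fin n → Fin k) i x → lookup (lookup (blocks f) i) x ≡ does (f x FinP.≟ i)
lookup-blocks f i x = trans (cong (λ p → lookup p x) (VecP.lookup∘tabulate _ i)) (VecP.lookup∘tabulate _ x)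

∈-blocks⁺ : ∀ {n k} (f : Fin n → Fin k) {i x} → f x ≡ i → x ∈ lookup (blocks f) i
∈-blocks⁺ f {i} {x} eq = VecP.lookup⇒[]= x _ (trans (lookup-blocks f i x) (dec-true (f x FinP.≟ i) eq))

∈-blocks⁻ : ∀ {n k} (f : Fin n → Fin k) {i x} → x ∈ lookup (blocks f) i → f x ≡ i
∈-blocks⁻ f {i} {x} x∈ with f x FinP.≟ i | trans (sym (VecP.[]=⇒lookup x∈)) (lookup-blocks f i x)
... | yes eq | _ = eq
... | no _   | ()

blocks-injective : ∀ {n k} (f g : Fin n → Fin k) → blocks f ≡ blocks g → f ≗ g
blocks-injective f g eq x =
  sym (∈-blocks⁻ g (subst (λ B → x ∈ lookup B (f x)) eq (∈-blocks⁺ f refl)))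

open IsPartition

blocks-partition : ∀ {n k} (f : Fin n → Fin k) → IsGrowing 0 f → IsPartition (blocks f)
blocks-partition f g .nonempty i with x , eq ← g .surjective i ℕ.z≤n = x , ∈-blocks⁺ f eq
blocks-partition f g .disjoint {i} {j} i≢j (x , x∈) with l , r ← SubsetP.x∈p∩q⁻ (lookup (blocks f) i) _ x∈ =
  i≢j (trans (sym (∈-blocks⁻ f l)) (∈-blocks⁻ f r))
blocks-partition f g .covering x = f x , ∈-blocks⁺ f refl
-- The minimum y of block j has a label above i, so some z before y has label i, and the minimum of
-- block i is at most z.
blocks-partition f g .min-increasing {i} {j} {x} {y} i<j (_ , x≤) (y∈ , _)
  with z , z<y , eq ← g .restricted {i} y ℕ.z≤n (subst (i Fin.<_) (sym (∈-blocks⁻ f y∈)) i<j) =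
  ℕP.≤-<-trans (x≤ (∈-blocks⁺ f eq)) z<y

∃-min : ∀ {n} (p : Subset n) {x} → x ∈ p → ∃ λ m → IsMin m p
∃-min (inside  ∷ p) _ = zero , here , λ _ → ℕ.z≤n
∃-min (outside ∷ p) (there x∈) with m , m∈ , m≤ ← ∃-min p x∈ =
  suc m , there m∈ , λ { (there y∈) → ℕ.s≤s (m≤ y∈) }

block-min : ∀ {n k} {B : Vec (Subset n) k} → IsPartition B → ∀ i → ∃ λ m → IsMin m (lookup B i)
block-min {B = B} part i = ∃-min (lookup B i) (proj₂ (nonempty part i))

block-unique : ∀ {n k} {B : Vec (Subset n) k} → IsPartition B → ∀ {i j x} →
  x ∈ lookup B i → x ∈ lookup B j → i ≡ j
block-unique part {i} {j} {x} x∈i x∈j with i FinP.≟ j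
... | yes eq = eq
... | no i≢j = contradiction (x , SubsetP.x∈p∩q⁺ (x∈i , x∈j)) (disjoint part i≢j)

-- Numbering each element by its block gives restricted growth: if block i comes before the block of
-- x, then its minimum precedes the minimum of that block, which is at most x. So the minimum of
-- block i is the earlier element required.
partition-growing : ∀ {n k} {B : Vec (Subset n) k} (part : IsPartition B) →
  IsGrowing 0 (proj₁ ∘ covering part)
partition-growing part .surjective i _ with x , x∈ ← nonempty part i =
  x , block-unique part (proj₂ (covering part x)) x∈
partition-growing part .restricted {i} x _ i<fx
  with m , min ← block-min part i | l , minₗ@(_ , l≤) ← block-min part (proj₁ (covering part x)) =
  m , ℕP.<-≤-trans (min-increasing part i<fx min minₗ) (l≤ (proj₂ (covering part x))) ,
  block-unique part (proj₂ (covering part m)) (proj₁ min)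

lookup-extensional : ∀ {A : Set} {k} (B C : Vec A k) → (∀ i → lookup B i ≡ lookup C i) → B ≡ C
lookup-extensional B C eq =
  trans (sym (VecP.tabulate∘lookup B)) (trans (VecP.tabulate-cong eq) (VecP.tabulate∘lookup C))

partition≡blocks : ∀ {n k} {B : Vec (Subset n) k} (part : IsPartition B) →
  blocks (proj₁ ∘ covering part) ≡ B
partition≡blocks {B = B} part = lookup-extensional _ _ λ i → SubsetP.⊆-antisym
  (λ x∈ → subst (λ j → _ ∈ lookup B j) (∈-blocks⁻ f x∈) (proj₂ (covering part _)))
  (λ x∈ → ∈-blocks⁺ f (block-unique part (proj₂ (covering part _)) x∈))
  where f = proj₁ ∘ covering part

-- Arrangements

strictlyMonotone⇒≤ : ∀ {k} (f : Fin k → Fin k) → (∀ {i j} → i Fin.< j → f i Fin.< f j) → ∀ i → i Fin.≤ f i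
strictlyMonotone⇒≤ f mono i = go (toℕ i) i refl
  where
  go : ∀ m i → toℕ i ≡ m → m ℕ.≤ toℕ (f i)
  go zero    i       _  = ℕ.z≤n
  go (suc m) (suc i) eq = ℕP.≤-<-trans
    (go m (Fin.inject₁ i) (trans (FinP.toℕ-inject₁ i) (ℕP.suc-injective eq)))
    (mono (ℕ.s≤s (ℕP.≤-reflexive (FinP.toℕ-inject₁ i))))

-- Blocks i and j of `C` have minima x < y. Equal images under f would make the two blocks coincide,
-- against disjointness; reversed images would give y < x in `B`.
relabelling-monotone : ∀ {n k} {B C : Vec (Subset n) k} → IsPartition B → IsPartition C →
  (f : Fin k → Fin k) → (∀ i → lookup C i ≡ lookup B (f i)) → ∀ {i j} → i Fin.< j → f i Fin.< f j
relabelling-monotone {B = B} {C} partB partC f eq {i} {j} i<j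
  with x , minx ← block-min partC i | y , miny ← block-min partC j | FinP.<-cmp (f i) (f j)
... | tri< fi<fj _ _ = fi<fj
... | tri≈ _ fi≡fj _ = contradiction
  (block-unique partC (proj₁ minx)
    (subst (x ∈_) (trans (eq i) (trans (cong (lookup B) fi≡fj) (sym (eq j)))) (proj₁ minx)))
  (FinP.<⇒≢ i<j)
... | tri> _ _ fj<fi = contradiction
  (min-increasing partC i<j minx miny)
  (ℕP.<⇒≯ (min-increasing partB fj<fi (subst (IsMin y) (eq j) miny) (subst (IsMin x) (eq i) minx)))

lookup-arrange : ∀ {n k} (B : Vec (Subset n) k) σ i → lookup (arrange B σ) i ≡ lookup B (σ ⟨$⟩ʳ i)
lookup-arrange B σ = VecP.lookup∘tabulate _

-- The two listings differ by the relabelling ρ = σ ∘ τ⁻¹. Both ρ and its inverse are strictly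
-- increasing, and a strictly increasing self-map never moves an index down; applied to both, this
-- forces ρ to be the identity.
arrange-injective : ∀ {n k} {B C : Vec (Subset n) k} → IsPartition B → IsPartition C →
  ∀ σ τ → arrange B σ ≡ arrange C τ → B ≡ C × σ Perm.≈ τ
arrange-injective {B = B} {C} partB partC σ τ eq =
  lookup-extensional B C (λ i → sym (trans (relabel i) (cong (lookup B) (ρ≡id i)))) ,
  (λ i → trans (cong (σ ⟨$⟩ʳ_) (sym (Perm.inverseˡ τ))) (ρ≡id (τ ⟨$⟩ʳ i)))
  where
  ρ = λ i → σ ⟨$⟩ʳ (τ ⟨$⟩ˡ i)
  ρ⁻¹ = λ i → τ ⟨$⟩ʳ (σ ⟨$⟩ˡ i)
  same : ∀ i → lookup B (σ ⟨$⟩ʳ i) ≡ lookup C (τ ⟨$⟩ʳ i)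
  same i = trans (sym (lookup-arrange B σ i)) (trans (cong (λ D → lookup D i) eq) (lookup-arrange C τ i))
  relabel : ∀ i → lookup C i ≡ lookup B (ρ i)
  relabel i = trans (cong (lookup C) (sym (Perm.inverseʳ τ))) (sym (same _))
  relabel⁻¹ : ∀ i → lookup B i ≡ lookup C (ρ⁻¹ i)
  relabel⁻¹ i = trans (cong (lookup B) (sym (Perm.inverseʳ σ))) (same _)
  ρ≡id : ∀ i → ρ i ≡ i
  ρ≡id i = FinP.≤-antisym
    (subst (ρ i Fin.≤_) (trans (cong (τ ⟨$⟩ʳ_) (Perm.inverseˡ σ)) (Perm.inverseʳ τ))
      (strictlyMonotone⇒≤ ρ⁻¹ (relabelling-monotone partC partB ρ⁻¹ relabel⁻¹) (ρ i)))
    (strictlyMonotone⇒≤ ρ (relabelling-monotone partB partC ρ relabel) i)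

-- Counting

Fin↔Swaps : ∀ k → Fin (fibonacci (suc k)) ↔ Swaps k
Fin↔Swaps zero = mk↔ₛ′ (λ _ → nil) (λ _ → zero) (λ { nil → refl }) (λ { zero → refl })
Fin↔Swaps (suc zero) = mk↔ₛ′ (λ _ → fix nil) (λ _ → zero) (λ { (fix nil) → refl }) (λ { zero → refl })
Fin↔Swaps (suc (suc k)) =
  mk↔ₛ′ (λ { (inj₁ s) → fix s ; (inj₂ s) → swap s }) (λ { (fix s) → inj₁ s ; (swap s) → inj₂ s })
        (λ { (fix s) → refl ; (swap s) → refl }) (λ { (inj₁ s) → refl ; (inj₂ s) → refl })
  ↔-∘ ((Fin↔Swaps (suc k) ⊎-↔ Fin↔Swaps k) ↔-∘ FinP.+↔⊎)

Code : ℕ → ℕ → Set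
Code n j = ∃ λ k → Growth n j k × Swaps k

Fin↔Code : ∀ n j → Fin (fibonacciFubini n j) ↔ Code n j
Fin↔Code zero j =
  mk↔ₛ′ (λ s → j , done , s) (λ { (_ , done , s) → s }) (λ { (_ , done , s) → refl }) (λ _ → refl)
  ↔-∘ Fin↔Swaps j
Fin↔Code (suc n) j =
  mk↔ₛ′ (λ { (inj₁ (i , k , c , s)) → k , old i c , s ; (inj₂ (k , c , s)) → k , new c , s })
        (λ { (k , old i c , s) → inj₁ (i , k , c , s) ; (k , new c , s) → inj₂ (k , c , s) })
        (λ { (k , old i c , s) → refl ; (k , new c , s) → refl })
        (λ { (inj₁ _) → refl ; (inj₂ _) → refl })
  ↔-∘ ((((↔-id _ ×-↔ Fin↔Code n j) ↔-∘ FinP.*↔×) ⊎-↔ Fin↔Code n (suc j)) ↔-∘ FinP.+↔⊎)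

decode : ∀ {n} → Code n 0 → ∃ λ k → Vec (Subset n) k
decode (k , c , s) = k , arrange (blocks (label c)) (swapsPerm s)

decode-injective : ∀ {n} (x y : Code n 0) → decode x ≡ decode y → x ≡ y
decode-injective (k , c , s) (k′ , d , t) eq with refl ← cong proj₁ eq =
  let B≡C , s≈t = arrange-injective
        (blocks-partition (label c) (label-growing c)) (blocks-partition (label d) (label-growing d))
        (swapsPerm s) (swapsPerm t) (ProductP.,-injectiveʳ-UIP ℕP.≡-irrelevant eq)
  in cong₂ (λ c s → k , c , s)
       (label-injective c d (blocks-injective (label c) (label d) B≡C)) (swapsPerm-injective s t s≈t)

decode-sound : ∀ {n} (x : Code n 0) → IsFibonacciOrderedPartition (proj₂ (decode x))
decode-sound (k , c , s) =
  blocks (label c) , swapsPerm s , blocks-partition (label c) (label-growing c) , swapsPerm-fibonacci s , refl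

decode-complete : ∀ {n k} (C : Vec (Subset n) k) → IsFibonacciOrderedPartition C → ∃ λ x → decode x ≡ (k , C)
decode-complete _ (B , σ , part , fib , refl) =
  let c , eq = label-complete _ ℕ.z≤n (partition-growing part)
      s , s≈ = swapsPerm-complete σ fib
      blocks≡ = trans (VecP.tabulate-cong λ i → VecP.tabulate-cong λ x → cong (λ l → does (l FinP.≟ i)) (eq x))
                      (partition≡blocks part)
  in (_ , c , s) , cong (_ ,_) (trans
       (cong (λ D → arrange D (swapsPerm s)) blocks≡)
       (VecP.tabulate-cong (cong (lookup B) ∘ s≈)))

fibonacciFubini-counts : ∀ n → IsFibonacciFubini n (fibonacciFubini n 0)
fibonacciFubini-counts n = Fin↔∃Refinement (VecP.≡-dec (VecP.≡-dec _≟ᵇ_)) IsFibonacciOrderedPartition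
  (decode ∘ to)
  (λ {i} {j} eq → trans (sym (strictlyInverseʳ i))
    (trans (cong from (decode-injective (to i) (to j) eq)) (strictlyInverseʳ j)))
  (decode-sound ∘ to)
  (λ C fop → let x , eq = decode-complete C fop in from x , trans (cong decode (strictlyInverseˡ x)) eq)
  where open Inverse (Fin↔Code n 0)

-- Closeness estimates for Cauchy representatives

∣p-q∣≡∣q-p∣ : ∀ p q → ∣ p ℚ.- q ∣ ≡ ∣ q ℚ.- p ∣
∣p-q∣≡∣q-p∣ p q = trans (cong ∣_∣ (solve 2 (λ p q → p :- q := :- (q :- p)) refl p q)) (ℚP.∣-p∣≡∣p∣ (q ℚ.- p))

∣p-r∣≤ : ∀ p q r {a b} → ∣ p ℚ.- q ∣ ℚ.≤ a → ∣ q ℚ.- r ∣ ℚ.≤ b → ∣ p ℚ.- r ∣ ℚ.≤ a ℚ.+ b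
∣p-r∣≤ p q r pq qr = ℚP.≤-trans
  (ℚP.≤-reflexive (cong ∣_∣ (solve 3 (λ p q r → p :- r := (p :- q) :+ (q :- r)) refl p q r)))
  (∣p+q∣≤ (p ℚ.- q) (q ℚ.- r) pq qr)

-- Here δ = ε/4 and η = ε/2. They are the budgets for the diagonal argument, which pays for a tail,
-- a fixed partial sum and a second tail.
split : ∀ ε → 0ℚ ℚ.< ε → ∃ λ δ → ∃ λ η → 0ℚ ℚ.< δ × 0ℚ ℚ.< η × δ ℚ.+ (η ℚ.+ δ) ≡ ε
split ε 0<ε = half (½ ℚ.* ε) (0<½* 0<ε) (½p+½p ε)
  where
  rearrange : ∀ p q → p ℚ.+ (q ℚ.+ p) ≡ (p ℚ.+ p) ℚ.+ q
  rearrange = solve 2 (λ p q → p :+ (q :+ p) := p :+ p :+ q) refl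
  half : ∀ η → 0ℚ ℚ.< η → η ℚ.+ η ≡ ε → ∃ λ δ → ∃ λ η → 0ℚ ℚ.< δ × 0ℚ ℚ.< η × δ ℚ.+ (η ℚ.+ δ) ≡ ε
  half η 0<η eq = ½ ℚ.* η , η , 0<½* 0<η , 0<η ,
    trans (rearrange (½ ℚ.* η) η) (trans (cong (ℚ._+ η) (½p+½p η)) eq)

Close-sym : ∀ {ε} x y → Close ε x y → Close ε y x
Close-sym x y (N , c) = N , λ {n} N≤n → subst (ℚ._≤ _) (∣p-q∣≡∣q-p∣ (seq x n) (seq y n)) (c N≤n)

Close-trans : ∀ {ε δ} x y z → Close ε x y → Close δ y z → Close (ε ℚ.+ δ) x z
Close-trans x y z (M , c) (N , d) = M ℕ.⊔ N , λ {n} ≤n →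
  ∣p-r∣≤ (seq x n) (seq y n) (seq z n) (c (ℕP.m⊔n≤o⇒m≤o M N ≤n)) (d (ℕP.m⊔n≤o⇒n≤o M N ≤n))

Close-+ : ∀ {ε δ} x y u v → Close ε x u → Close δ y v → Close (ε ℚ.+ δ) (x + y) (u + v)
Close-+ x y u v (M , c) (N , d) = M ℕ.⊔ N , λ {n} ≤n → ℚP.≤-trans
  (ℚP.≤-reflexive (cong ∣_∣ (solve 4 (λ x y u v → (x :+ y) :- (u :+ v) := (x :- u) :+ (y :- v)) refl
    (seq x n) (seq y n) (seq u n) (seq v n))))
  (∣p+q∣≤ (seq x n ℚ.- seq u n) (seq y n ℚ.- seq v n) (c (ℕP.m⊔n≤o⇒m≤o M N ≤n)) (d (ℕP.m⊔n≤o⇒n≤o M N ≤n)))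

Close-neg : ∀ {ε} x y → Close ε x y → Close ε (- x) (- y)
Close-neg x y (N , c) = N , λ {n} N≤n → ℚP.≤-trans
  (ℚP.≤-reflexive (trans
    (cong ∣_∣ (solve 2 (λ x y → :- x :- :- y := y :- x) refl (seq x n) (seq y n)))
    (∣p-q∣≡∣q-p∣ (seq y n) (seq x n))))
  (c N≤n)

Close-scale : ∀ {ε} c x y (b : Cauchy.EventuallyBounded (seq c)) →
  Close ε x y → Close (proj₁ b ℚ.* ε) (c * x) (c * y)
Close-scale c x y (B , _ , M , c≤B) (N , x~y) = M ℕ.⊔ N , λ {n} ≤n → ℚP.≤-trans
  (ℚP.≤-reflexive (cong ∣_∣ (solve 3 (λ c x y → c :* x :- c :* y := c :* (x :- y)) refl
    (seq c n) (seq x n) (seq y n))))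
  (∣p*q∣≤ (seq c n) (seq x n ℚ.- seq y n) (c≤B (ℕP.m⊔n≤o⇒m≤o M N ≤n)) (x~y (ℕP.m⊔n≤o⇒n≤o M N ≤n)))

-- Limits of sequences of reals; HasSum f s is partialSum f ⟶ s.

infix 4 _⟶_

_⟶_ : (ℕ → ℝ) → ℝ → Set
a ⟶ s = ∀ ε → 0ℚ ℚ.< ε → ∃ λ M → ∀ {m} → M ℕ.≤ m → Close ε (a m) s

⟶-resp-≃ : ∀ a b s → (∀ m → a m ≃ b m) → b ⟶ s → a ⟶ s
⟶-resp-≃ a b s a≃b b⟶s ε 0<ε with M , close ← b⟶s (½ ℚ.* ε) (0<½* 0<ε) = M , λ {m} M≤m →
  subst (λ ε → Close ε (a m) s) (½p+½p ε)
    (Close-trans (a m) (b m) s (a≃b m (½ ℚ.* ε) (0<½* 0<ε)) (close M≤m))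

⟶-limit-resp-≃ : ∀ a s t → s ≃ t → a ⟶ s → a ⟶ t
⟶-limit-resp-≃ a s t s≃t a⟶s ε 0<ε with M , close ← a⟶s (½ ℚ.* ε) (0<½* 0<ε) = M , λ {m} M≤m →
  subst (λ ε → Close ε (a m) t) (½p+½p ε)
    (Close-trans (a m) s t (close M≤m) (s≃t (½ ℚ.* ε) (0<½* 0<ε)))

⟶-+ : ∀ a b s t → a ⟶ s → b ⟶ t → (λ m → a m + b m) ⟶ s + t
⟶-+ a b s t a⟶s b⟶t ε 0<ε
  with M , closeᵃ ← a⟶s (½ ℚ.* ε) (0<½* 0<ε) | N , closeᵇ ← b⟶t (½ ℚ.* ε) (0<½* 0<ε) =
  M ℕ.⊔ N , λ {m} ≤m → subst (λ ε → Close ε (a m + b m) (s + t)) (½p+½p ε)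
    (Close-+ (a m) (b m) s t (closeᵃ (ℕP.m⊔n≤o⇒m≤o M N ≤m)) (closeᵇ (ℕP.m⊔n≤o⇒n≤o M N ≤m)))

⟶-scale : ∀ c a s → a ⟶ s → (λ m → c * a m) ⟶ c * s
⟶-scale c a s a⟶s ε 0<ε
  with b@(B , 0<B , _) ← Cauchy.eventually-bounded (seq c) (cauchy c)
  with M , close ← a⟶s (ε ℚ.* recip 0<B) (0<* 0<ε (0<recip 0<B)) = M , λ {m} M≤m →
  subst (λ ε → Close ε (c * a m) (c * s)) (*-recip-cancel 0<B ε) (Close-scale c (a m) s b (close M≤m))

⟶-tail : ∀ a s → a ⟶ s → (a ∘ suc) ⟶ s
⟶-tail a s a⟶s ε 0<ε with M , close ← a⟶s ε 0<ε = M , λ M≤m → close (ℕP.m≤n⇒m≤1+n M≤m)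

⟶-untail : ∀ a s → (a ∘ suc) ⟶ s → a ⟶ s
⟶-untail a s a⟶s ε 0<ε with M , close ← a⟶s ε 0<ε = suc M , λ { (ℕ.s≤s M≤m) → close M≤m }

-- The ring of reals

infix 4 _≈_

-- Unlike x ≃ y, which unfolds, this lets Agda infer x and y.
record _≈_ (x y : ℝ) : Set where
  constructor equal
  field ≈⇒≃ : x ≃ y

open _≈_

≡⇒≈ : ∀ x y → (∀ n → seq x n ≡ seq y n) → x ≈ y
≡⇒≈ x y eq = equal λ ε 0<ε → 0 , λ {n} _ → begin
  ∣ seq x n ℚ.- seq y n ∣  ≡⟨ cong (λ t → ∣ t ℚ.- seq y n ∣) (eq n) ⟩
  ∣ seq y n ℚ.- seq y n ∣  ≡⟨ cong ∣_∣ (ℚP.+-inverseʳ (seq y n)) ⟩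
  0ℚ                       ≤⟨ ℚP.<⇒≤ 0<ε ⟩
  ε                        ∎
  where open ℚP.≤-Reasoning

≈-sym : ∀ {x y} → x ≈ y → y ≈ x
≈-sym {x} {y} (equal x≃y) = equal λ ε 0<ε → Close-sym x y (x≃y ε 0<ε)

≈-trans : ∀ {x y z} → x ≈ y → y ≈ z → x ≈ z
≈-trans {x} {y} {z} (equal x≃y) (equal y≃z) = equal λ ε 0<ε →
  subst (λ ε → Close ε x z) (½p+½p ε)
    (Close-trans x y z (x≃y (½ ℚ.* ε) (0<½* 0<ε)) (y≃z (½ ℚ.* ε) (0<½* 0<ε)))

+-cong : ∀ {x y u v} → x ≈ y → u ≈ v → x + u ≈ y + v
+-cong {x} {y} {u} {v} (equal x≃y) (equal u≃v) = equal λ ε 0<ε →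
  subst (λ ε → Close ε (x + u) (y + v)) (½p+½p ε)
    (Close-+ x u y v (x≃y (½ ℚ.* ε) (0<½* 0<ε)) (u≃v (½ ℚ.* ε) (0<½* 0<ε)))

*-congˡ : ∀ c {x y} → x ≈ y → c * x ≈ c * y
*-congˡ c {x} {y} (equal x≃y) = equal λ ε 0<ε →
  let b@(B , 0<B , _) = Cauchy.eventually-bounded (seq c) (cauchy c)
  in subst (λ ε → Close ε (c * x) (c * y)) (*-recip-cancel 0<B ε)
       (Close-scale c x y b (x≃y (ε ℚ.* recip 0<B) (0<* 0<ε (0<recip 0<B))))

*-comm : ∀ x y → x * y ≈ y * x
*-comm x y = ≡⇒≈ (x * y) (y * x) λ n → ℚP.*-comm (seq x n) (seq y n)

*-cong : ∀ {x y u v} → x ≈ y → u ≈ v → x * u ≈ y * v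
*-cong {x} {y} {u} {v} x≈y u≈v = ≈-trans (*-congˡ x u≈v)
  (≈-trans (*-comm x v) (≈-trans (*-congˡ v x≈y) (*-comm v y)))

isCommutativeRing : IsCommutativeRing _≈_ _+_ _*_ -_ (fromℕ 0) (fromℕ 1)
isCommutativeRing = record
  { isRing = record
    { +-isAbelianGroup = record
      { isGroup = record
        { isMonoid = record
          { isSemigroup = record
            { isMagma = record
              { isEquivalence = record
                { refl = λ {x} → ≡⇒≈ x x λ _ → refl ; sym = ≈-sym ; trans = ≈-trans }
              ; ∙-cong = +-cong
              }
            ; assoc = λ x y z → ≡⇒≈ (x + y + z) (x + (y + z)) λ n → ℚP.+-assoc (seq x n) (seq y n) (seq z n)
            }
          ; identity =
              (λ x → ≡⇒≈ (fromℕ 0 + x) x λ n → ℚP.+-identityˡ (seq x n)) ,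
              (λ x → ≡⇒≈ (x + fromℕ 0) x λ n → ℚP.+-identityʳ (seq x n))
          }
        ; inverse =
            (λ x → ≡⇒≈ (- x + x) (fromℕ 0) λ n → ℚP.+-inverseˡ (seq x n)) ,
            (λ x → ≡⇒≈ (x + - x) (fromℕ 0) λ n → ℚP.+-inverseʳ (seq x n))
        ; ⁻¹-cong = λ {x} {y} (equal x≃y) → equal λ ε 0<ε → Close-neg x y (x≃y ε 0<ε)
        }
      ; comm = λ x y → ≡⇒≈ (x + y) (y + x) λ n → ℚP.+-comm (seq x n) (seq y n)
      }
    ; *-cong = *-cong
    ; *-assoc = λ x y z → ≡⇒≈ (x * y * z) (x * (y * z)) λ n → ℚP.*-assoc (seq x n) (seq y n) (seq z n)
    ; *-identity =
        (λ x → ≡⇒≈ (fromℕ 1 * x) x λ n → ℚP.*-identityˡ (seq x n)) ,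
        (λ x → ≡⇒≈ (x * fromℕ 1) x λ n → ℚP.*-identityʳ (seq x n))
    ; distrib =
        (λ x y z → ≡⇒≈ (x * (y + z)) (x * y + x * z) λ n → ℚP.*-distribˡ-+ (seq x n) (seq y n) (seq z n)) ,
        (λ x y z → ≡⇒≈ ((y + z) * x) (y * x + z * x) λ n → ℚP.*-distribʳ-+ (seq x n) (seq y n) (seq z n))
    }
  ; *-comm = *-comm
  }

ℝ-commutativeRing : CommutativeRing 0ℓ 0ℓ
ℝ-commutativeRing = record { isCommutativeRing = isCommutativeRing }

-- Geometrically dominated series

-- The head costs at most C, and the remaining series is dominated with C/2 in place of C, so by
-- induction it costs at most C/2 + C/2.
partialSum-bounded : ∀ f C i → (∀ k → ∣ seq (f k) i ∣ ℚ.≤ C ℚ.* ½^ k) → 0ℚ ℚ.≤ C →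
  ∀ m → ∣ seq (partialSum f m) i ∣ ℚ.≤ C ℚ.+ C
partialSum-bounded f C i f≤ 0≤C zero    = ℚP.+-mono-≤ 0≤C 0≤C
partialSum-bounded f C i f≤ 0≤C (suc m) = ℚP.≤-trans
  (∣p+q∣≤ (seq (f 0) i) (seq (partialSum (f ∘ suc) m) i) (f≤ 0)
    (partialSum-bounded (f ∘ suc) (C ℚ.* ½) i
      (λ k → ℚP.≤-trans (f≤ (suc k)) (ℚP.≤-reflexive (sym (ℚP.*-assoc C ½ (½^ k)))))
      (*-mono-≤ {r = 0ℚ} ℚP.≤-refl 0≤C 0≤C (ℚP.≤ᵇ⇒≤ _)) m))
  (ℚP.≤-reflexive (cong₂ ℚ._+_ (ℚP.*-identityʳ C)
    (trans (cong₂ ℚ._+_ (ℚP.*-comm C ½) (ℚP.*-comm C ½)) (½p+½p C))))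

partialSum-tail-bounded : ∀ f C i → (∀ k → ∣ seq (f k) i ∣ ℚ.≤ C ℚ.* ½^ k) → 0ℚ ℚ.≤ C →
  ∀ n {m} → n ℕ.≤ m → ∣ seq (partialSum f m) i ℚ.- seq (partialSum f n) i ∣ ℚ.≤ (C ℚ.+ C) ℚ.* ½^ n
partialSum-tail-bounded f C i f≤ 0≤C zero {m} _ = subst₂ ℚ._≤_
  (cong ∣_∣ (sym (ℚP.+-identityʳ (seq (partialSum f m) i)))) (sym (ℚP.*-identityʳ (C ℚ.+ C)))
  (partialSum-bounded f C i f≤ 0≤C m)
partialSum-tail-bounded f C i f≤ 0≤C (suc n) {suc m} (ℕ.s≤s n≤m) = begin
  ∣ (a ℚ.+ p) ℚ.- (a ℚ.+ q) ∣
    ≡⟨ cong ∣_∣ (solve 3 (λ a p q → (a :+ p) :- (a :+ q) := p :- q) refl a p q) ⟩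
  ∣ p ℚ.- q ∣
    ≤⟨ partialSum-tail-bounded (f ∘ suc) (C ℚ.* ½) i
      (λ k → ℚP.≤-trans (f≤ (suc k)) (ℚP.≤-reflexive (sym (ℚP.*-assoc C ½ (½^ k)))))
      (*-mono-≤ {r = 0ℚ} ℚP.≤-refl 0≤C 0≤C (ℚP.≤ᵇ⇒≤ _)) n n≤m ⟩
  (C ℚ.* ½ ℚ.+ C ℚ.* ½) ℚ.* ½^ n
    ≡⟨ solve 3 (λ C h p → (C :* h :+ C :* h) :* p := (C :+ C) :* (h :* p)) refl C ½ (½^ n) ⟩
  (C ℚ.+ C) ℚ.* ½^ (suc n) ∎
  where
  open ℚP.≤-Reasoning
  a = seq (f 0) i
  p = seq (partialSum (f ∘ suc) m) i
  q = seq (partialSum (f ∘ suc) n) i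

module _ (f : ℕ → ℝ) (C : ℚ) (0<C : 0ℚ ℚ.< C) (f≤ : ∀ i k → ∣ seq (f k) i ∣ ℚ.≤ C ℚ.* ½^ k) where

  private
    0<2C : 0ℚ ℚ.< C ℚ.+ C
    0<2C = ℚP.+-mono-< 0<C 0<C

    -- M does not depend on the index i, because one C dominates the terms at every index. This
    -- uniformity is what makes the diagonal a Cauchy sequence.
    uniformly-close : ∀ ε → 0ℚ ℚ.< ε → ∃ λ M → ∀ i {m} → M ℕ.≤ m →
      ∣ seq (partialSum f m) i ℚ.- seq (partialSum f M) i ∣ ℚ.≤ ε
    uniformly-close ε 0<ε with M , ½^M≤ ← ½^-archimedean (ε ℚ.* recip 0<2C) (0<* 0<ε (0<recip 0<2C)) =
      M , λ i {m} M≤m → ℚP.≤-trans (partialSum-tail-bounded f C i (f≤ i) (ℚP.<⇒≤ 0<C) M M≤m)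
        (ℚP.≤-trans (ℚP.*-monoˡ-≤-nonNeg (C ℚ.+ C) {{ℚ.nonNegative (ℚP.<⇒≤ 0<2C)}} ½^M≤)
                    (ℚP.≤-reflexive (*-recip-cancel 0<2C ε)))

    -- Writing S for the partial sums, the path is from S_m at m to S_M at m, then to S_M at n, then
    -- to S_n at n. The outer legs are series tails, and the middle one is the Cauchy property of
    -- the single real S_M.
    diagonal-close : ∀ δ ε M N →
      (∀ i {m} → M ℕ.≤ m → ∣ seq (partialSum f m) i ℚ.- seq (partialSum f M) i ∣ ℚ.≤ δ) →
      (∀ {m n} → N ℕ.≤ m → N ℕ.≤ n → ∣ seq (partialSum f M) m ℚ.- seq (partialSum f M) n ∣ ℚ.≤ ε) →
      ∀ {m n} → M ℕ.⊔ N ℕ.≤ m → M ℕ.⊔ N ℕ.≤ n →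
      ∣ seq (partialSum f m) m ℚ.- seq (partialSum f n) n ∣ ℚ.≤ δ ℚ.+ (ε ℚ.+ δ)
    diagonal-close δ ε M N tail≤ head≤ {m} {n} ≤m ≤n =
      ∣p-r∣≤ (seq (partialSum f m) m) (seq (partialSum f M) m) (seq (partialSum f n) n)
        (tail≤ m (ℕP.m⊔n≤o⇒m≤o M N ≤m))
        (∣p-r∣≤ (seq (partialSum f M) m) (seq (partialSum f M) n) (seq (partialSum f n) n)
          (head≤ (ℕP.m⊔n≤o⇒n≤o M N ≤m) (ℕP.m⊔n≤o⇒n≤o M N ≤n))
          (ℚP.≤-trans (ℚP.≤-reflexive (∣p-q∣≡∣q-p∣ (seq (partialSum f M) n) (seq (partialSum f n) n)))
            (tail≤ n (ℕP.m⊔n≤o⇒m≤o M N ≤n))))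

    diagonal-cauchy′ : ∀ δ ε → 0ℚ ℚ.< δ → 0ℚ ℚ.< ε → ∃ λ N → ∀ {m n} → N ℕ.≤ m → N ℕ.≤ n →
      ∣ seq (partialSum f m) m ℚ.- seq (partialSum f n) n ∣ ℚ.≤ δ ℚ.+ (ε ℚ.+ δ)
    diagonal-cauchy′ δ ε 0<δ 0<ε = M ℕ.⊔ N , diagonal-close δ ε M N (proj₂ tails) (proj₂ heads)
      where
      tails = uniformly-close δ 0<δ
      M = proj₁ tails
      heads : ∃ λ N → ∀ {m n} → N ℕ.≤ m → N ℕ.≤ n → ∣ seq (partialSum f M) m ℚ.- seq (partialSum f M) n ∣ ℚ.≤ ε
      heads = cauchy (partialSum f M) ε 0<ε
      N = proj₁ heads

    diagonal-cauchy : IsCauchy (λ i → seq (partialSum f i) i)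
    diagonal-cauchy ε 0<ε = go (split ε 0<ε)
      where
      go : (∃ λ δ → ∃ λ η → 0ℚ ℚ.< δ × 0ℚ ℚ.< η × δ ℚ.+ (η ℚ.+ δ) ≡ ε) → ∃ λ N → ∀ {m n} → N ℕ.≤ m → N ℕ.≤ n →
        ∣ seq (partialSum f m) m ℚ.- seq (partialSum f n) n ∣ ℚ.≤ ε
      go (δ , η , 0<δ , 0<η , refl) = diagonal-cauchy′ δ η 0<δ 0<η

  limit : ℝ
  limit = mkℝ (λ i → seq (partialSum f i) i) diagonal-cauchy

  limit-sum : HasSum f limit
  -- The same M bounds the number of terms and the index: at index n, both S_m and the diagonal
  -- entry S_n are within ε/2 of S_M.
  limit-sum ε 0<ε = M , λ {m} M≤m → M , λ {n} M≤n → ℚP.≤-trans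
    (∣p-r∣≤ (seq (partialSum f m) n) (seq (partialSum f M) n) (seq (partialSum f n) n)
      (proj₂ tails n M≤m)
      (ℚP.≤-trans (ℚP.≤-reflexive (∣p-q∣≡∣q-p∣ (seq (partialSum f M) n) (seq (partialSum f n) n))) (proj₂ tails n M≤n)))
    (ℚP.≤-reflexive (½p+½p ε))
    where
    tails = uniformly-close (½ ℚ.* ε) (0<½* 0<ε)
    M = proj₁ tails

-- Arithmetic of inverse factorials

infix 9 1/_!

1/_! : ℕ → ℚ
1/ k ! = (+ 1 ℚ./ k !) {{k !≢0}}

/≡*1/ : ∀ a d .{{_ : ℕ.NonZero d}} → + a ℚ./ d ≡ (+ a ℚ./ 1) ℚ.* (+ 1 ℚ./ d)
/≡*1/ a (suc d) = ℚP.toℚᵘ-injective (ℚᵘP.≃-trans (ℚP.toℚᵘ-fromℚᵘ (ℚᵘ.mkℚᵘ (+ a) d)) (ℚᵘP.≃-sym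
  (ℚᵘP.≃-trans (ℚP.toℚᵘ-homo-* (+ a ℚ./ 1) (+ 1 ℚ./ suc d))
  (ℚᵘP.≃-trans (ℚᵘP.*-cong (fromℕᵘ a) (ℚP.toℚᵘ-fromℚᵘ (ℚᵘ.mkℚᵘ (+ 1) d)))
  (ℚᵘ.*≡* (cong₂ ℤ._*_ (ℤP.*-identityʳ (+ a)) (cong +_ (sym (ℕP.+-identityʳ (suc d))))))))))

1/!-suc : ∀ k → (+ suc k ℚ./ 1) ℚ.* 1/ suc k ! ≡ 1/ k !
1/!-suc k = trans (sym (/≡*1/ (suc k) (suc k !) {{suc k !≢0}})) (cancel (k !) {{k !≢0}})
  where
  cancel : ∀ d .{{_ : ℕ.NonZero d}} → (+ suc k ℚ./ (suc k ℕ.* d)) {{ℕP.m*n≢0 (suc k) d}} ≡ + 1 ℚ./ d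
  cancel (suc d) = ℚP.fromℚᵘ-cong {ℚᵘ.mkℚᵘ (+ suc k) (d ℕ.+ k ℕ.* suc d)} {ℚᵘ.mkℚᵘ (+ 1) d}
    (ℚᵘ.*≡* (sym (ℤP.*-identityˡ (+ (suc k ℕ.* suc d)))))

1/!-nonNegative : ∀ k → 0ℚ ℚ.≤ 1/ k !
1/!-nonNegative k = ℚP.nonNegative⁻¹ (1/ k !) {{ℚP.normalize-nonNeg 1 (k !) {{k !≢0}}}}

fromℕ-mono-≤ : ∀ {m n} → m ℕ.≤ n → + m ℚ./ 1 ℚ.≤ + n ℚ./ 1
fromℕ-mono-≤ {n = n} ℕ.z≤n = ℚP.nonNegative⁻¹ (+ n ℚ./ 1) {{ℚP.normalize-nonNeg n 1}}
fromℕ-mono-≤ {suc m} {suc n} (ℕ.s≤s m≤n) = subst₂ ℚ._≤_ (sym (fromℕ-suc m)) (sym (fromℕ-suc n))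
  (ℚP.+-monoʳ-≤ 1ℚ (fromℕ-mono-≤ m≤n))

-- The exponential series

swap-factors : ∀ s p w → s ℚ.* (p ℚ.* w) ≡ p ℚ.* (s ℚ.* w)
swap-factors = solve 3 (λ s p w → s :* (p :* w) := p :* (s :* w)) refl

expTerm : ℝ → ℕ → ℝ
expTerm x k = x ^ k * fromℚ (1/ k !)

-- The ratio test: consecutive terms have ratio x/(k+1). The hypothesis bounds that ratio by r with
-- the denominator cleared.
expTerm-step : ∀ x i k {r} → ∣ seq x i ∣ ℚ.≤ r ℚ.* (+ suc k ℚ./ 1) →
  ∣ seq (expTerm x (suc k)) i ∣ ℚ.≤ r ℚ.* ∣ seq (expTerm x k) i ∣
expTerm-step x i k {r} x≤ = step (seq x i) (seq (x ^ k) i) x≤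
  where
  open ℚP.≤-Reasoning
  w = 1/ suc k !
  s = + suc k ℚ./ 1
  step : ∀ y p → ∣ y ∣ ℚ.≤ r ℚ.* s → ∣ y ℚ.* p ℚ.* w ∣ ℚ.≤ r ℚ.* ∣ p ℚ.* 1/ k ! ∣
  step y p y≤ = begin
    ∣ y ℚ.* p ℚ.* w ∣          ≡⟨ cong ∣_∣ (ℚP.*-assoc y p w) ⟩
    ∣ y ℚ.* (p ℚ.* w) ∣        ≤⟨ ∣p*q∣≤ y (p ℚ.* w) y≤ ℚP.≤-refl ⟩
    r ℚ.* s ℚ.* ∣ p ℚ.* w ∣    ≡⟨ ℚP.*-assoc r s ∣ p ℚ.* w ∣ ⟩
    r ℚ.* (s ℚ.* ∣ p ℚ.* w ∣)  ≡⟨ cong (λ t → r ℚ.* (t ℚ.* ∣ p ℚ.* w ∣)) (ℚP.0≤p⇒∣p∣≡p (fromℕ-mono-≤ {n = suc k} ℕ.z≤n)) ⟨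
    r ℚ.* (∣ s ∣ ℚ.* ∣ p ℚ.* w ∣)  ≡⟨ cong (r ℚ.*_) (ℚP.∣p*q∣≡∣p∣*∣q∣ s (p ℚ.* w)) ⟨
    r ℚ.* ∣ s ℚ.* (p ℚ.* w) ∣  ≡⟨ cong (λ t → r ℚ.* ∣ t ∣) (swap-factors s p w) ⟩
    r ℚ.* ∣ p ℚ.* (s ℚ.* w) ∣  ≡⟨ cong (λ t → r ℚ.* ∣ p ℚ.* t ∣) (1/!-suc k) ⟩
    r ℚ.* ∣ p ℚ.* 1/ k ! ∣     ∎

16ℚ : ℚ
16ℚ = + 16 ℚ./ 1

module _ (x : ℝ) where

  expTerm-halves : ∀ i k N C → ∣ seq x i ∣ ℚ.≤ ½ ℚ.* (+ N ℚ./ 1) → N ℕ.≤ suc k →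
    ∣ seq (expTerm x k) i ∣ ℚ.≤ C ℚ.* ½^ k → ∣ seq (expTerm x (suc k)) i ∣ ℚ.≤ C ℚ.* ½^ (suc k)
  expTerm-halves i k N C x≤ N≤ t≤ = begin
    ∣ seq (expTerm x (suc k)) i ∣
      ≤⟨ expTerm-step x i k {½} (ℚP.≤-trans x≤ (ℚP.*-monoˡ-≤-nonNeg ½ (fromℕ-mono-≤ N≤))) ⟩
    ½ ℚ.* ∣ seq (expTerm x k) i ∣
      ≤⟨ ℚP.*-monoˡ-≤-nonNeg ½ t≤ ⟩
    ½ ℚ.* (C ℚ.* ½^ k)
      ≡⟨ swap-factors ½ C (½^ k) ⟩
    C ℚ.* ½^ (suc k) ∎
    where
    open ℚP.≤-Reasoning

  -- From k = 1 on the ratio is at most 1/2, which makes the constant 2 suffice. It is needed for β: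
  -- after four terms it leaves a tail of at most (2 + 2)/16 = 1/4, whereas the constant 16 would
  -- only give 2. The terms of `exp` do not depend on the constant used to prove convergence, so
  -- this sharper bound applies to them too.
  expTerm-1≤ : ∀ i → ∣ seq x i ∣ ℚ.≤ 1ℚ → ∀ k → ∣ seq (expTerm x k) i ∣ ℚ.≤ 2ℚ ℚ.* ½^ k
  expTerm-1≤ i x≤ 0 = ℚP.≤ᵇ⇒≤ _
  expTerm-1≤ i x≤ 1 = expTerm-step x i 0 {1ℚ} x≤
  expTerm-1≤ i x≤ (suc (suc k)) =
    expTerm-halves i (suc k) 2 2ℚ x≤ (ℕ.s≤s (ℕ.s≤s ℕ.z≤n)) (expTerm-1≤ i x≤ (suc k))

  -- The first four terms are at most 2 = 16 · ½³, and later ones halve.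
  expTerm-2≤ : ∀ i → ∣ seq x i ∣ ℚ.≤ 2ℚ → ∀ k → ∣ seq (expTerm x k) i ∣ ℚ.≤ 16ℚ ℚ.* ½^ k
  expTerm-2≤ i x≤ k = go k
    where
    t≤1 : ∣ seq (expTerm x 0) i ∣ ℚ.≤ 1ℚ
    t≤1 = ℚP.≤ᵇ⇒≤ _
    t≤2 : ∣ seq (expTerm x 1) i ∣ ℚ.≤ 2ℚ
    t≤2 = ℚP.≤-trans (expTerm-step x i 0 {2ℚ} x≤) (ℚP.*-monoˡ-≤-nonNeg 2ℚ t≤1)
    t≤2′ : ∣ seq (expTerm x 2) i ∣ ℚ.≤ 2ℚ
    t≤2′ = ℚP.≤-trans (expTerm-step x i 1 {1ℚ} x≤) (ℚP.*-monoˡ-≤-nonNeg 1ℚ t≤2)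
    t≤2″ : ∣ seq (expTerm x 3) i ∣ ℚ.≤ 2ℚ
    t≤2″ = ℚP.≤-trans (expTerm-step x i 2 {1ℚ} (ℚP.≤-trans x≤ (ℚP.≤ᵇ⇒≤ _))) (ℚP.*-monoˡ-≤-nonNeg 1ℚ t≤2′)
    go : ∀ k → ∣ seq (expTerm x k) i ∣ ℚ.≤ 16ℚ ℚ.* ½^ k
    go 0 = ℚP.≤-trans t≤1 (ℚP.≤ᵇ⇒≤ _)
    go 1 = ℚP.≤-trans t≤2 (ℚP.≤ᵇ⇒≤ _)
    go 2 = ℚP.≤-trans t≤2′ (ℚP.≤ᵇ⇒≤ _)
    go 3 = ℚP.≤-trans t≤2″ (ℚP.≤ᵇ⇒≤ _)
    go (suc k@(suc (suc (suc _)))) =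
      expTerm-halves i k 4 16ℚ x≤ (ℕ.s≤s (ℕ.s≤s (ℕ.s≤s (ℕ.s≤s ℕ.z≤n)))) (go k)

-- The Dobiński series

module R = CommutativeRing ℝ-commutativeRing
open Touchard R.commutativeSemiring

⟦⟧≈fromℕ : ∀ n → ⟦ n ⟧ ≈ fromℕ n
⟦⟧≈fromℕ zero    = R.refl
⟦⟧≈fromℕ (suc n) = R.trans (R.+-congˡ {fromℕ 1} (⟦⟧≈fromℕ n))
  (≡⇒≈ (fromℕ 1 + fromℕ n) (fromℕ (suc n)) λ _ → sym (fromℕ-suc n))

weight : ℕ → ℝ
weight k = fromℚ (1/ k !)

weight-suc : ∀ k → ⟦ suc k ⟧ * weight (suc k) ≈ weight k
weight-suc k = R.trans (R.*-congʳ {weight (suc k)} (⟦⟧≈fromℕ (suc k)))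
  (≡⇒≈ (fromℕ (suc k) * weight (suc k)) (weight k) λ _ → 1/!-suc k)

open Algebra.Definitions.RawSemiring (Semiring.rawSemiring R.semiring) using () renaming (_^_ to _^ᴿ_)

-- The two powers are taken in raw semirings that differ in their equality.
^≡^ᴿ : ∀ x k → x ^ k ≡ x ^ᴿ k
^≡^ᴿ x zero    = refl
^≡^ᴿ x (suc k) = cong (x *_) (^≡^ᴿ x k)

module _ (x : ℝ) where

  dobińskiTerm≈term : ∀ n k → dobińskiTerm x n k ≈ term x weight weight-suc n 0 k
  dobińskiTerm≈term n k = R.*-cong (R.reflexive (^≡^ᴿ x k)) (R.trans
    (≡⇒≈ (fromℚ ((+ (k ℕ.^ n) ℚ./ k !) {{k !≢0}})) (fromℕ (k ℕ.^ n) * weight k) λ _ → /≡*1/ (k ℕ.^ n) (k !) {{k !≢0}})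
    (R.*-congʳ {weight k} (R.sym (⟦⟧≈fromℕ (k ℕ.^ n)))))

  module _ (e : ℝ) (e-exp : IsExp x e) where

    -- For n = 0 the factor (j+k)⁰ is 1 and the series is the exponential one. The step takes limits
    -- in `∑-term-suc`, which describes only nonempty partial sums; hence the passage through
    -- shifted sequences.
    term-sum : ∀ n j → HasSum (term x weight weight-suc n j) (touchard x n j * e)
    term-sum zero j = ⟶-limit-resp-≃ (partialSum t) e (fromℕ 1 * e) (_≈_.≈⇒≃ (R.sym (R.*-identityˡ e)))
      (⟶-resp-≃ (partialSum t) (partialSum (expTerm x)) e (λ m → _≈_.≈⇒≃ (∑-cong t (expTerm x) t≈ m)) e-exp)
      where
      t = term x weight weight-suc 0 j
      t≈ : ∀ k → t k ≈ expTerm x k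
      t≈ k = R.*-cong (R.reflexive (sym (^≡^ᴿ x k))) (R.trans (R.*-congʳ {weight k} (R.+-identityʳ (fromℕ 1))) (R.*-identityˡ (weight k)))
    term-sum (suc n) j = ⟶-untail (partialSum t) (touchard x (suc n) j * e)
      (⟶-limit-resp-≃ (partialSum t ∘ suc) s (touchard x (suc n) j * e) (_≈_.≈⇒≃ s≈)
      (⟶-resp-≃ (partialSum t ∘ suc) (λ m → ⟦ j ⟧ * partialSum u (suc m) + x * partialSum v m) s
        (λ m → _≈_.≈⇒≃ (∑-term-suc x weight weight-suc n j m))
      (⟶-+ (λ m → ⟦ j ⟧ * partialSum u (suc m)) (λ m → x * partialSum v m)
           (⟦ j ⟧ * (touchard x n j * e)) (x * (touchard x n (suc j) * e))
        (⟶-scale ⟦ j ⟧ (partialSum u ∘ suc) (touchard x n j * e)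
          (⟶-tail (partialSum u) (touchard x n j * e) (term-sum n j)))
        (⟶-scale x (partialSum v) (touchard x n (suc j) * e) (term-sum n (suc j))))))
      where
      t = term x weight weight-suc (suc n) j
      u = term x weight weight-suc n j
      v = term x weight weight-suc n (suc j)
      s = ⟦ j ⟧ * (touchard x n j * e) + x * (touchard x n (suc j) * e)
      s≈ : s ≈ touchard x (suc n) j * e
      s≈ = R.sym (R.trans (R.distribʳ e (⟦ j ⟧ * touchard x n j) (x * touchard x n (suc j)))
        (R.+-cong (R.*-assoc ⟦ j ⟧ (touchard x n j) e) (R.*-assoc x (touchard x n (suc j)) e)))

    dobiński-sum : ∀ n → HasSum (dobińskiTerm x n) (touchard x n 0 * e)
    dobiński-sum n = ⟶-resp-≃ (partialSum (dobińskiTerm x n)) (partialSum (term x weight weight-suc n 0)) (touchard x n 0 * e)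
      (λ m → _≈_.≈⇒≃ (∑-cong (dobińskiTerm x n) (term x weight weight-suc n 0) (dobińskiTerm≈term n) m))
      (term-sum n 0)

-- The exponentials of α and β, and their apartness from zero

exp : ∀ x → (∀ i → ∣ seq x i ∣ ℚ.≤ 2ℚ) → ℝ
exp x x≤ = limit (expTerm x) 16ℚ (ℚP.positive⁻¹ 16ℚ) (λ i → expTerm-2≤ x i (x≤ i))

exp-isExp : ∀ x x≤ → IsExp x (exp x x≤)
exp-isExp x x≤ = limit-sum (expTerm x) 16ℚ (ℚP.positive⁻¹ 16ℚ) (λ i → expTerm-2≤ x i (x≤ i))

approx≤3 : ∀ i → approx i ℚ.≤ 3ℚ
approx≤3 i = Rational.p*p≤5⇒p≤3 (approx i) (approx²≤5 i)

0≤α : ∀ i → 0ℚ ℚ.≤ seq α i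
0≤α i = ℚP.≤-trans (ℚP.≤ᵇ⇒≤ _) (ℚP.*-monoʳ-≤-nonNeg ½ (ℚP.+-monoʳ-≤ 1ℚ (2≤approx i)))

-- Every `approx i` lies in [2, 3], so the terms of α lie in [3/2, 2] and those of β in [-1, -1/2].
α≤2 : ∀ i → ∣ seq α i ∣ ℚ.≤ 2ℚ
α≤2 i = ℚP.≤-trans (ℚP.≤-reflexive (ℚP.0≤p⇒∣p∣≡p (0≤α i)))
  (ℚP.*-monoʳ-≤-nonNeg ½ (ℚP.+-monoʳ-≤ 1ℚ (approx≤3 i)))

β≤0 : ∀ i → seq β i ℚ.≤ 0ℚ
β≤0 i = ℚP.≤-trans (ℚP.*-monoʳ-≤-nonNeg ½ (ℚP.+-monoʳ-≤ 1ℚ (ℚP.neg-antimono-≤ (2≤approx i)))) (ℚP.≤ᵇ⇒≤ _)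

-1≤β : ∀ i → ℚ.- 1ℚ ℚ.≤ seq β i
-1≤β i = ℚP.*-monoʳ-≤-nonNeg ½ (ℚP.+-monoʳ-≤ 1ℚ (ℚP.neg-antimono-≤ (approx≤3 i)))

∣p∣≤1 : ∀ p → p ℚ.≤ 0ℚ → ℚ.- 1ℚ ℚ.≤ p → ∣ p ∣ ℚ.≤ 1ℚ
∣p∣≤1 p p≤0 -1≤p = begin
  ∣ p ∣      ≡⟨ ℚP.∣-p∣≡∣p∣ p ⟨
  ∣ ℚ.- p ∣  ≡⟨ ℚP.0≤p⇒∣p∣≡p (ℚP.neg-antimono-≤ p≤0) ⟩
  ℚ.- p      ≤⟨ ℚP.neg-antimono-≤ -1≤p ⟩
  1ℚ         ∎
  where open ℚP.≤-Reasoning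

β≤1 : ∀ i → ∣ seq β i ∣ ℚ.≤ 1ℚ
β≤1 i = ∣p∣≤1 (seq β i) (β≤0 i) (-1≤β i)

β≤2 : ∀ i → ∣ seq β i ∣ ℚ.≤ 2ℚ
β≤2 i = ℚP.≤-trans (β≤1 i) (ℚP.≤ᵇ⇒≤ _)

0≤p*q : ∀ p q → 0ℚ ℚ.≤ p → 0ℚ ℚ.≤ q → 0ℚ ℚ.≤ p ℚ.* q
0≤p*q p q 0≤p 0≤q = ℚP.nonNegative⁻¹ (p ℚ.* q)
  {{ℚP.nonNeg*nonNeg⇒nonNeg p {{ℚ.nonNegative 0≤p}} q {{ℚ.nonNegative 0≤q}}}}

partialSum-nonNegative : ∀ f i → (∀ k → 0ℚ ℚ.≤ seq (f k) i) → ∀ m → 0ℚ ℚ.≤ seq (partialSum f m) i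
partialSum-nonNegative f i 0≤f zero    = ℚP.≤-refl
partialSum-nonNegative f i 0≤f (suc m) = ℚP.+-mono-≤ (0≤f 0) (partialSum-nonNegative (f ∘ suc) i (0≤f ∘ suc) m)

-- The term k = 0 contributes 1 and the others are nonnegative. At index 0 the diagonal is the empty
-- sum, so the bound starts at `suc i`.
1≤exp : ∀ x x≤ i → 0ℚ ℚ.≤ seq x (suc i) → 1ℚ ℚ.≤ seq (exp x x≤) (suc i)
1≤exp x x≤ i 0≤x = ℚP.+-mono-≤ {1ℚ} {1ℚ} {0ℚ} ℚP.≤-refl
  (partialSum-nonNegative (expTerm x ∘ suc) (suc i) (λ k → 0≤p*q (seq (x ^ suc k) (suc i)) (1/ suc k !)
     (^-nonNegative (suc k)) (1/!-nonNegative (suc k))) i)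
  where
  ^-nonNegative : ∀ k → 0ℚ ℚ.≤ seq (x ^ k) (suc i)
  ^-nonNegative zero    = ℚP.≤ᵇ⇒≤ _
  ^-nonNegative (suc k) = 0≤p*q (seq x (suc i)) (seq (x ^ k) (suc i)) 0≤x (^-nonNegative k)

exp-α#0 : exp α α≤2 #0
exp-α#0 = 1ℚ , 0<1 , 1 , λ
  { {suc i} _ → ℚP.≤-trans (1≤exp α α≤2 i (0≤α (suc i)))
      (ℚP.≤-reflexive (sym (ℚP.0≤p⇒∣p∣≡p (ℚP.≤-trans (ℚP.<⇒≤ 0<1) (1≤exp α α≤2 i (0≤α (suc i))))))) }

⅓ ⅙ : ℚ
⅓ = + 1 ℚ./ 3
⅙ = + 1 ℚ./ 6

-- The Taylor polynomial 1 + x + x²/2 + x³/6, spelled exactly as the partial sum of four terms of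
-- `expTerm` computes, so that bounds on it apply there without rewriting.
cubic : ℚ → ℚ
cubic x = 1ℚ ℚ.* 1ℚ ℚ.+ (x ℚ.* 1ℚ ℚ.* 1ℚ ℚ.+ (x ℚ.* (x ℚ.* 1ℚ) ℚ.* ½ ℚ.+ (x ℚ.* (x ℚ.* (x ℚ.* 1ℚ)) ℚ.* ⅙ ℚ.+ 0ℚ)))

-- Expansion about -1: with y = x + 1 the quadratic term cancels and 1/3 + y/2 + y³/6 remains, with
-- no negative coefficient.
cubic≡ : ∀ x → cubic x ≡ ⅓ ℚ.+ (x ℚ.+ 1ℚ) ℚ.* ((x ℚ.+ 1ℚ) ℚ.* (x ℚ.+ 1ℚ) ℚ.+ 3ℚ) ℚ.* ⅙
cubic≡ = solve 1 (λ x → con 1ℚ :* con 1ℚ :+ (x :* con 1ℚ :* con 1ℚ :+ (x :* (x :* con 1ℚ) :* con ½ :+ (x :* (x :* (x :* con 1ℚ)) :* con ⅙ :+ con 0ℚ)))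
  := con ⅓ :+ (x :+ con 1ℚ) :* ((x :+ con 1ℚ) :* (x :+ con 1ℚ) :+ con 3ℚ) :* con ⅙) refl

⅓≤cubic : ∀ x → ℚ.- 1ℚ ℚ.≤ x → ⅓ ℚ.≤ cubic x
⅓≤cubic x -1≤x = begin
  ⅓                                               ≡⟨ ℚP.+-identityʳ ⅓ ⟨
  ⅓ ℚ.+ 0ℚ                                        ≤⟨ ℚP.+-monoʳ-≤ ⅓ (0≤p*q (y ℚ.* (y ℚ.* y ℚ.+ 3ℚ)) ⅙
                                                       (0≤p*q y (y ℚ.* y ℚ.+ 3ℚ) 0≤y (ℚP.+-mono-≤ (0≤p*q y y 0≤y 0≤y) (ℚP.nonNegative⁻¹ 3ℚ)))
                                                       (ℚP.nonNegative⁻¹ ⅙)) ⟩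
  ⅓ ℚ.+ y ℚ.* (y ℚ.* y ℚ.+ 3ℚ) ℚ.* ⅙              ≡⟨ cubic≡ x ⟨
  cubic x                                         ∎
  where
  open ℚP.≤-Reasoning
  y = x ℚ.+ 1ℚ
  0≤y : 0ℚ ℚ.≤ y
  0≤y = ℚP.+-monoˡ-≤ 1ℚ -1≤x

p≤∣p∣ : ∀ p → p ℚ.≤ ∣ p ∣
p≤∣p∣ p with ℚP.≤-total 0ℚ p
... | inj₁ 0≤p = ℚP.≤-reflexive (sym (ℚP.0≤p⇒∣p∣≡p 0≤p))
... | inj₂ p≤0 = ℚP.≤-trans p≤0 (ℚP.0≤∣p∣ p)

lower-bound : ∀ p q {a b} → ∣ p ℚ.- q ∣ ℚ.≤ b → a ℚ.+ b ℚ.≤ q → a ℚ.≤ p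
lower-bound p q {a} {b} p~q a+b≤q = begin
  a                        ≡⟨ solve 2 (λ a b → a := a :+ b :- b) refl a b ⟩
  a ℚ.+ b ℚ.- b            ≤⟨ ℚP.+-mono-≤ a+b≤q (ℚP.neg-antimono-≤ q-p≤b) ⟩
  q ℚ.- (q ℚ.- p)          ≡⟨ solve 2 (λ p q → q :- (q :- p) := p) refl p q ⟩
  p                        ∎
  where
  open ℚP.≤-Reasoning
  q-p≤b : q ℚ.- p ℚ.≤ b
  q-p≤b = ℚP.≤-trans (p≤∣p∣ (q ℚ.- p)) (ℚP.≤-trans (ℚP.≤-reflexive (∣p-q∣≡∣q-p∣ q p)) p~q)

-- The partial sum 1 + x + x²/2 + x³/6 stays above 1/3 on [-1, 0], and the
-- rest of the series contributes at most 1/4.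
exp-β#0 : exp β β≤2 #0
exp-β#0 = + 1 ℚ./ 12 , ℚP.positive⁻¹ (+ 1 ℚ./ 12) , 4 , λ {i} 4≤i → ℚP.≤-trans
  (lower-bound (seq (exp β β≤2) i) (seq (partialSum (expTerm β) 4) i)
    (partialSum-tail-bounded (expTerm β) 2ℚ i (expTerm-1≤ β i (β≤1 i)) (ℚP.nonNegative⁻¹ 2ℚ) 4 4≤i)
    (⅓≤cubic (seq β i) (-1≤β i)))
  (p≤∣p∣ (seq (exp β β≤2) i))

-- The quadratic equations of α and β

√5+β≈α : √5 + β ≈ α
√5+β≈α = ≡⇒≈ (√5 + β) α (identity ∘ approx)
  where
  identity : ∀ s → s ℚ.+ (1ℚ ℚ.- s) ℚ.* ½ ≡ (1ℚ ℚ.+ s) ℚ.* ½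
  identity = solve 1 (λ s → s :+ (con 1ℚ :- s) :* con ½ := (con 1ℚ :+ s) :* con ½) refl

-- If s² = 5 then x = (1 ± s)/2 satisfies x² − (x + 1) = (s² − 5)/4 = 0.
golden : ∀ x → (∀ i → seq x i ℚ.* seq x i ≡ (seq x i ℚ.+ 1ℚ) ℚ.+ (approx i ℚ.* approx i ℚ.- 5ℚ) ℚ.* (½ ℚ.* ½)) →
  x * x ≈ x + fromℕ 1
golden x eq = R.trans (≡⇒≈ (x * x) (x + fromℕ 1 + (√5 * √5 - fromℕ 5) * fromℚ (½ ℚ.* ½)) eq)
  (R.trans (R.+-congˡ {x + fromℕ 1} (R.trans
    (R.*-congʳ {fromℚ (½ ℚ.* ½)} (R.trans (R.+-congʳ { - fromℕ 5} (equal √5*√5≃5)) (R.-‿inverseʳ (fromℕ 5))))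
    (R.zeroˡ (fromℚ (½ ℚ.* ½)))))
    (R.+-identityʳ (x + fromℕ 1)))

α²≈α+1 : α * α ≈ α + fromℕ 1
α²≈α+1 = golden α (identity ∘ approx)
  where
  identity : ∀ s → (1ℚ ℚ.+ s) ℚ.* ½ ℚ.* ((1ℚ ℚ.+ s) ℚ.* ½) ≡ ((1ℚ ℚ.+ s) ℚ.* ½ ℚ.+ 1ℚ) ℚ.+ (s ℚ.* s ℚ.- 5ℚ) ℚ.* (½ ℚ.* ½)
  identity = solve 1 (λ s → (con 1ℚ :+ s) :* con ½ :* ((con 1ℚ :+ s) :* con ½)
    := ((con 1ℚ :+ s) :* con ½ :+ con 1ℚ) :+ (s :* s :- con 5ℚ) :* (con ½ :* con ½)) refl

β²≈β+1 : β * β ≈ β + fromℕ 1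
β²≈β+1 = golden β (identity ∘ approx)
  where
  identity : ∀ s → (1ℚ ℚ.- s) ℚ.* ½ ℚ.* ((1ℚ ℚ.- s) ℚ.* ½) ≡ ((1ℚ ℚ.- s) ℚ.* ½ ℚ.+ 1ℚ) ℚ.+ (s ℚ.* s ℚ.- 5ℚ) ℚ.* (½ ℚ.* ½)
  identity = solve 1 (λ s → (con 1ℚ :- s) :* con ½ :* ((con 1ℚ :- s) :* con ½)
    := ((con 1ℚ :- s) :* con ½ :+ con 1ℚ) :+ (s :* s :- con 5ℚ) :* (con ½ :* con ½)) refl

-- Cancelling the exponentials and √5

private module S = Algebra.Solver.Ring.NaturalCoefficients.Default R.commutativeSemiring
open Relation.Binary.Reasoning.Setoid R.setoid

cancel-exp : ∀ a t e (e#0 : e #0) → (a / e [ e#0 ]) * (t * e) ≈ a * t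
cancel-exp a t e e#0 = begin
  (a * inv e e#0) * (t * e)
    ≈⟨ S.solve 4 (λ a i t e → (a S.:* i) S.:* (t S.:* e) S.:= (a S.:* t) S.:* (e S.:* i)) R.refl a (inv e e#0) t e ⟩
  (a * t) * (e * inv e e#0)
    ≈⟨ R.*-congˡ {a * t} (equal (*-inv e e#0)) ⟩
  (a * t) * fromℕ 1
    ≈⟨ R.*-identityʳ (a * t) ⟩
  a * t ∎

fibonacciFubini-dobiński : ∀ n → fromℕ (fibonacciFubini n 0) ≈
  inv √5 √5#0 * ((α / exp α α≤2 [ exp-α#0 ]) * (touchard α n 0 * exp α α≤2)
               - (β / exp β β≤2 [ exp-β#0 ]) * (touchard β n 0 * exp β β≤2))
fibonacciFubini-dobiński n = begin
  F
    ≈⟨ R.*-identityˡ F ⟨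
  fromℕ 1 * F
    ≈⟨ R.*-congʳ {F} (equal (*-inv √5 √5#0)) ⟨
  √5 * inv √5 √5#0 * F
    ≈⟨ S.solve 3 (λ s i f → s S.:* i S.:* f S.:= i S.:* (s S.:* f)) R.refl √5 (inv √5 √5#0) F ⟩
  inv √5 √5#0 * (√5 * F)
    ≈⟨ R.*-congˡ {inv √5 √5#0} difference ⟩
  inv √5 √5#0 * (α * touchard α n 0 - β * touchard β n 0)
    ≈⟨ R.*-congˡ {inv √5 √5#0} (R.+-cong (cancel-exp α (touchard α n 0) (exp α α≤2) exp-α#0)
         (R.-‿cong (cancel-exp β (touchard β n 0) (exp β β≤2) exp-β#0))) ⟨
  inv √5 √5#0 * ((α / exp α α≤2 [ exp-α#0 ]) * (touchard α n 0 * exp α α≤2)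
               - (β / exp β β≤2 [ exp-β#0 ]) * (touchard β n 0 * exp β β≤2)) ∎
  where
  F = fromℕ (fibonacciFubini n 0)
  Tα = α * touchard α n 0
  Tβ = β * touchard β n 0
  sum≈ : √5 * F + Tβ ≈ Tα
  sum≈ = begin
    √5 * F + Tβ
      ≈⟨ R.+-cong (R.*-congˡ {√5} (⟦⟧≈fromℕ (fibonacciFubini n 0)))
                  (R.*-congʳ {touchard β n 0} (R.*-identityʳ β)) ⟨
    √5 * ⟦ fibonacciFubini n 0 ⟧ + β * fromℕ 1 * touchard β n 0
      ≈⟨ fibonacciFubini-touchard α β √5 √5+β≈α α²≈α+1 β²≈β+1 n 0 ⟩
    α * fromℕ 1 * touchard α n 0
      ≈⟨ R.*-congʳ {touchard α n 0} (R.*-identityʳ α) ⟩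
    Tα ∎
  -- The identity comes from a semiring, with the β part on the left; only here is it moved across
  -- by subtraction.
  difference : √5 * F ≈ Tα - Tβ
  difference = begin
    √5 * F               ≈⟨ R.+-identityʳ (√5 * F) ⟨
    √5 * F + fromℕ 0     ≈⟨ R.+-congˡ {√5 * F} (R.-‿inverseʳ Tβ) ⟨
    √5 * F + (Tβ - Tβ)   ≈⟨ R.+-assoc (√5 * F) Tβ (- Tβ) ⟨
    √5 * F + Tβ - Tβ     ≈⟨ R.+-congʳ { - Tβ} sum≈ ⟩
    Tα - Tβ              ∎

theorem5 : (n : ℕ) →
    ∃ λ 𝓕ₙ → IsFibonacciFubini n 𝓕ₙ ×
    (∃ λ e^α → ∃ λ e^β → ∃ λ Sα → ∃ λ Sβ →
    Σ (e^α #0) λ e^α#0 → Σ (e^β #0) λ e^β#0 →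
    IsExp α e^α × IsExp β e^β ×
    HasSum (dobińskiTerm α n) Sα × HasSum (dobińskiTerm β n) Sβ ×
    fromℕ 𝓕ₙ ≃ inv √5 √5#0 *
    ((α / e^α [ e^α#0 ]) * Sα - (β / e^β [ e^β#0 ]) * Sβ))
theorem5 n =
  fibonacciFubini n 0 , fibonacciFubini-counts n ,
  exp α α≤2 , exp β β≤2 , touchard α n 0 * exp α α≤2 , touchard β n 0 * exp β β≤2 , exp-α#0 , exp-β#0 ,
  exp-isExp α α≤2 , exp-isExp β β≤2 ,
  dobiński-sum α (exp α α≤2) (exp-isExp α α≤2) n , dobiński-sum β (exp β β≤2) (exp-isExp β β≤2) n ,
  _≈_.≈⇒≃ (fibonacciFubini-dobiński n)
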